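{- Let $G$ be an odd 2-dd all of whose alternating cycles have exactly 6 arcs, let $F$ be an open proper subgraph of $G$ with $n\geq 1$ exit vertices, and let $F'$ be an arbitrary open 2-digraph, all of whose alternating cycles have exactly 6 arcs, with the same number $n$ of exit vertices as $F$. Suppose $F'\sim F$, i.e. $R_F=xR_{F'}y$ for some $x,y\in S_n$. Then $F$ can be replaced by $F'$ in $G$ so that the resulting 2-dd $G'$ (all of whose alternating cycles have exactly 6 arcs) is H-equivalent to $G$.
   Context: **Permutations.** $S_n$ is the symmetric group on $\{1,\dots,n\}$, $A_n$ the set of even permutations, $\overline{A}_n=S_n-A_n$, and $C_n\subset S_n$ the set of permutations consisting of a single cycle of length $n$. A set $P\subseteq S_n$ is uniform if it is non-empty and either $P\subseteq A_n$ ($\pi(P)=0$) or $P\subseteq\overline{A}_n$ ($\pi(P)=1$); for an integer $n$, $\pi(n)\in\{0,1\}$ is its parity. For uniform $P$, $E_P=P^{ -1}C_n=\{p^{ -1}c: p\in P, c\in C_n\}$, and the residue is $R_P=\overline{A}_n-E_P$ if $\pi(P)=\pi(n)$, and $R_P=A_n-E_P$ otherwise. **Graphs.** A 2-digraph is a finite digraph in which each vertex has (in-degree, out-degree) equal to $(0,2)$ (an entry vertex), $(2,0)$ (an exit vertex) or $(2,2)$ (a saturated vertex). A 2-dd is a 2-digraph all of whose vertices are saturated. An alternating cycle (AC) is a sequence of $2r$ distinct arcs $(e_0,\dots,e_{2r-1})$ such that $e_i$ and $e_{i+1}$ (indices mod $2r$) have a common end-vertex if $i$ is even and a common start-vertex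 if $i$ is odd; its forward arcs are the $e_i$ with $i$ even and its backward arcs those with $i$ odd. The arc set of a 2-digraph is uniquely partitioned into ACs. A subgraph of a 2-dd $G$ means the 2-digraph induced by a non-empty set $K$ of ACs of $G$ (all arcs of these ACs and their end-points); it is proper if $K$ is not the set of all ACs, and its complement is the subgraph $\overline{F}$ induced by the remaining ACs. The entry vertices of $F$ are exactly the exit vertices of $\overline{F}$, and vice versa. A factor of a 2-digraph is a spanning subgraph which, for every AC, contains either all its forward arcs and none of its backward arcs, or vice versa; it is a disjoint union of directed cycles and directed paths from entry to exit vertices. A factor is open if it contains no cycle; a 2-digraph is open if it has an open factor. The route of a factor is the bijection from entry vertices to exit vertices sending each entry vertex to the end of the path starting there; a route is open if it is the route of at least one open factor. Labelling entry and exit vertices by $1,\dots,n$ makes routes permutations in $S_n$; when all ACs have 6 arcs the set of open routes of an open 2-digraph is uniform, and $R_F$ denotes the residue of this set (a change of labelling replaces $R_F$ by $uR_Fv$ for some $u,v\in S_n$, so $\sim$ does not depend on the labellings). A 2-dd is odd if every factor has an odd number of cycles. It is Hamiltonian if it has a directed cycle through all vertices. Two 2-dds are H-equivalent if both are Hamiltonian or both are non-Hamiltonian. **Replacement.** Replacing $F$ by $F'$ in $G$ means forming a 2-dd from the disjoint union of $\overline{F}$ and $F'$ by identifying the exit vertices of $\overline{F}$ with the entry vertices of $F'$ via some bijection, and the exit vertices of $F'$ with the entry vertices of $\overline{F}$ via some bijection; the claim is that such bijections exist making the result H-equivalent to $G$. -}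

module Defs where

open import Data.Bool.Base using (Bool; true; false; T; not; if_then_else_)
open import Data.Bool.Properties using (T-irrelevant)
open import Data.Fin.Base using (Fin; zero; suc; toℕ)
import Data.Fin.Properties as Fin
open import Data.Fin.Permutation using (Permutation′; _⟨$⟩ʳ_; _∘ₚ_; flip; _≈_)
open import Data.List.Base using (List; length; filter; map; allFin; cartesianProduct)
open import Data.List.Membership.Propositional using (_∈_; lose; find)
open import Data.List.Membership.Propositional.Properties using (∈-map⁺; ∈-allFin)
open import Data.List.Relation.Unary.Any as Any using ()
open import Data.Nat.Base using (ℕ; zero; suc; _*_; parity)
open import Data.Nat.DivMod using (_mod_)
open import Data.Parity.Base using (Parity; 0ℙ; 1ℙ)
import Data.Parity.Properties as Parity
open import Data.Product.Base using (Σ; ∃; ∃-syntax; Σ-syntax; _×_; _,_; proj₁)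
open import Data.Sum.Base using (_⊎_; inj₁; inj₂; [_,_]′) renaming (map to map-⊎)
open import Data.Unit.Base using (tt)
open import Function.Base using (_∘_)
open import Function.Bundles using (_↔_; _⇔_; Inverse; Bijection; mk↔ₛ′; mk⇔)
open import Function.Construct.Composition using (_↔-∘_)
open import Function.Definitions using (Injective; Surjective)
open import Function.Properties.Inverse using (Inverse⇒Injection)
open import Level using (0ℓ)
open import Relation.Binary.Bundles using (Setoid)
open import Relation.Binary.Construct.Closure.Equivalence using (EqClosure)
open import Relation.Binary.Construct.Closure.ReflexiveTransitive using (Star)
open import Relation.Binary.Definitions using (DecidableEquality)
open import Relation.Binary.PropositionalEquality
  using (_≡_; refl; sym; cong; subst; setoid)
open import Relation.Nullary using (¬_; Dec)
open import Relation.Nullary.Decidable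
  using (True; ⌊_⌋; fromWitness; map′; _×-dec_; _⊎-dec_; T?; via-injection)
open import Relation.Unary using (Pred; _≐_)

------------------------------------------------------------------------
-- Cyclic successor

next : ∀ {n} → Fin n → Fin n
next {suc n} i = suc (toℕ i) mod suc n

------------------------------------------------------------------------
-- Finite types

record Finite (A : Set) : Set where
  field
    size : ℕ
    enum : A ↔ Fin size

  _≟_ : DecidableEquality A
  _≟_ = via-injection (Inverse⇒Injection enum) Fin._≟_

  elements : List A
  elements = map (Inverse.from enum) (allFin size)

  ∈-elements : ∀ x → x ∈ elements
  ∈-elements x =
    subst (_∈ elements) (Inverse.inverseʳ enum refl)
      (∈-map⁺ (Inverse.from enum) (∈-allFin (Inverse.to enum x)))

  any? : {P : A → Set} → (∀ x → Dec (P x)) → Dec (∃ P)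
  any? P? = map′ (λ p → let (x , _ , px) = find p in x , px)
                 (λ (x , px) → lose (∈-elements x) px)
                 (Any.any? P? elements)

open Finite using (size; enum; elements)

Σ-T-≡ : {A : Set} {P : A → Bool} {x y : Σ A (T ∘ P)} →
        proj₁ x ≡ proj₁ y → x ≡ y
Σ-T-≡ {x = a , p} {y = .a , q} refl = cong (a ,_) (T-irrelevant p q)

Σ-Fin-finite : ∀ {n} (P : Fin n → Bool) → Finite (Σ (Fin n) (T ∘ P))
Σ-Fin-finite {zero} P = record
  { size = 0
  ; enum = mk↔ₛ′ (λ ()) (λ ()) (λ ()) (λ ())
  }
Σ-Fin-finite {suc n} P = cons (P zero) refl
  where
  module R = Finite (Σ-Fin-finite (P ∘ suc))

  shift : Σ (Fin n) (T ∘ P ∘ suc) → Σ (Fin (suc n)) (T ∘ P)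
  shift (i , p) = suc i , p

  cons : ∀ b → P zero ≡ b → Finite (Σ (Fin (suc n)) (T ∘ P))
  cons true eq = record { size = suc R.size ; enum = mk↔ₛ′ to from to-from from-to }
    where
    to : Σ (Fin (suc n)) (T ∘ P) → Fin (suc R.size)
    to (zero  , p) = zero
    to (suc i , p) = suc (Inverse.to R.enum (i , p))

    from : Fin (suc R.size) → Σ (Fin (suc n)) (T ∘ P)
    from zero    = zero , subst T (sym eq) tt
    from (suc j) = shift (Inverse.from R.enum j)

    to-from : ∀ j → to (from j) ≡ j
    to-from zero    = refl
    to-from (suc j) = cong suc (Inverse.inverseˡ R.enum refl)

    from-to : ∀ x → from (to x) ≡ x
    from-to (zero  , p) = Σ-T-≡ refl
    from-to (suc i , p) = cong shift (Inverse.inverseʳ R.enum refl)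
  cons false eq = record { size = R.size ; enum = mk↔ₛ′ to from to-from from-to }
    where
    to : Σ (Fin (suc n)) (T ∘ P) → Fin R.size
    to (zero  , p) with () ← subst T eq p
    to (suc i , p) = Inverse.to R.enum (i , p)

    from : Fin R.size → Σ (Fin (suc n)) (T ∘ P)
    from j = shift (Inverse.from R.enum j)

    to-from : ∀ j → to (from j) ≡ j
    to-from j = Inverse.inverseˡ R.enum refl

    from-to : ∀ x → from (to x) ≡ x
    from-to (zero  , p) with () ← subst T eq p
    from-to (suc i , p) = cong shift (Inverse.inverseʳ R.enum refl)

Σ-finite : {A : Set} → Finite A → (P : A → Bool) → Finite (Σ A (T ∘ P))
Σ-finite {A} A-fin P = record { size = size Fin-fin ; enum = enum Fin-fin ↔-∘ A↔Fin }
  where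
  open Inverse (enum A-fin)
  Fin-fin = Σ-Fin-finite (P ∘ from)

  A↔Fin : Σ A (T ∘ P) ↔ Σ (Fin (size A-fin)) (T ∘ P ∘ from)
  A↔Fin = mk↔ₛ′
    (λ (x , p) → to x , subst (T ∘ P) (sym (inverseʳ refl)) p)
    (λ (i , p) → from i , p)
    (λ _ → Σ-T-≡ (inverseˡ refl))
    (λ _ → Σ-T-≡ (inverseʳ refl))

------------------------------------------------------------------------
-- Permutations

inversions : ∀ {n} → Permutation′ n → ℕ
inversions {n} σ = length (filter inversion? (cartesianProduct (allFin n) (allFin n)))
  where
  inversion? : ((i , j) : Fin n × Fin n) → Dec _
  inversion? (i , j) = (i Fin.<? j) ×-dec ((σ ⟨$⟩ʳ j) Fin.<? (σ ⟨$⟩ʳ i))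

sgn : ∀ {n} → Permutation′ n → Parity
sgn σ = parity (inversions σ)

-- C_n: σ = (c₀ c₁ … c₍ₙ₋₁₎) in cycle notation.
IsFullCycle : ∀ {n} → Pred (Permutation′ n) 0ℓ
IsFullCycle {n} σ =
  Σ[ c ∈ Permutation′ n ] (∀ i → σ ⟨$⟩ʳ (c ⟨$⟩ʳ i) ≡ c ⟨$⟩ʳ next i)

-- Juxtaposition of permutations composes as functions, whereas _∘ₚ_ applies
-- its left argument first: p⁻¹c is c ∘ₚ flip p.
E : ∀ {n} → Pred (Permutation′ n) 0ℓ → Pred (Permutation′ n) 0ℓ
E P σ = ∃[ p ] ∃[ c ] P p × IsFullCycle c × σ ≈ (c ∘ₚ flip p)

residueParity : Parity → ℕ → Parity
residueParity π n = if ⌊ π Parity.≟ parity n ⌋ then 1ℙ else 0ℙ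

-- π(P) is read off from a member of P, all members of a uniform set having the
-- same parity.
Residue : ∀ {n} → Pred (Permutation′ n) 0ℓ → Pred (Permutation′ n) 0ℓ
Residue {n} P σ =
  (∃[ p ] P p × sgn σ ≡ residueParity (sgn p) n) × ¬ E P σ

infix 8 _·_·_

_·_·_ : ∀ {n} → Permutation′ n → Pred (Permutation′ n) 0ℓ → Permutation′ n →
        Pred (Permutation′ n) 0ℓ
(x · R · y) σ = ∃[ τ ] R τ × σ ≈ (y ∘ₚ τ ∘ₚ x)

------------------------------------------------------------------------
-- Digraphs

-- Loops and parallel arcs are allowed (parallel arcs out of a vertex and into
-- a vertex of in-degree 2 form an alternating cycle with two arcs).
record Digraph : Set₁ where
  field
    Vertex Arc    : Set
    vertex-finite : Finite Vertex
    arc-finite    : Finite Arc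
    src tgt       : Arc → Vertex

  open Finite vertex-finite public using () renaming (_≟_ to _≟ᵥ_)

  inDegree outDegree : Vertex → ℕ
  inDegree  v = length (filter (λ a → tgt a ≟ᵥ v) (elements arc-finite))
  outDegree v = length (filter (λ a → src a ≟ᵥ v) (elements arc-finite))

  IsEntry IsExit IsSaturated : Vertex → Set
  IsEntry     v = inDegree v ≡ 0 × outDegree v ≡ 2
  IsExit      v = inDegree v ≡ 2 × outDegree v ≡ 0
  IsSaturated v = inDegree v ≡ 2 × outDegree v ≡ 2

  Entry Exit : Set
  Entry = Σ Vertex IsEntry
  Exit  = Σ Vertex IsExit

open Digraph using (Vertex; Arc; src; tgt; Entry; Exit)

Is2Digraph : Digraph → Set
Is2Digraph G = ∀ v → IsEntry v ⊎ IsExit v ⊎ IsSaturated v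
  where open Digraph G

Is2DD : Digraph → Set
Is2DD G = ∀ v → Digraph.IsSaturated G v

------------------------------------------------------------------------
-- Directed cycles

record DirectedCycle (G : Digraph) : Set where
  field
    {length-1}  : ℕ
    arc         : Fin (suc length-1) → Arc G
    consecutive : ∀ i → tgt G (arc i) ≡ src G (arc (next i))
    distinct    : Injective _≡_ _≡_ (src G ∘ arc)

  _∈arcs : Pred (Arc G) 0ℓ
  a ∈arcs = ∃[ i ] arc i ≡ a

open DirectedCycle using (arc)

IsHamiltonian : Digraph → Set
IsHamiltonian G = Σ[ c ∈ DirectedCycle G ] (∀ v → ∃[ i ] src G (arc c i) ≡ v)

H-Equivalent : Digraph → Digraph → Set
H-Equivalent G H =
  (IsHamiltonian G × IsHamiltonian H) ⊎ (¬ IsHamiltonian G × ¬ IsHamiltonian H)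

-- The directed cycles of the spanning subgraph with arc set Φ, identified when
-- they have the same arcs, i.e. when they differ by the choice of first arc.
CyclesIn : (G : Digraph) → (Arc G → Bool) → Setoid 0ℓ 0ℓ
CyclesIn G Φ = record
  { Carrier       = Σ[ c ∈ DirectedCycle G ] (∀ i → T (Φ (arc c i)))
  ; _≈_           = λ (c , _) (d , _) → ∀ a → DirectedCycle._∈arcs c a ⇔ DirectedCycle._∈arcs d a
  ; isEquivalence = record
    { refl  = λ a → mk⇔ (λ p → p) (λ p → p)
    ; sym   = λ f a → mk⇔ (from (f a)) (to (f a))
    ; trans = λ f g a → mk⇔ (to (g a) ∘ to (f a)) (from (f a) ∘ from (g a))
    }
  }
  where open Function.Bundles.Equivalence using (to; from)

HasCycleCount : (G : Digraph) → (Arc G → Bool) → ℕ → Set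
HasCycleCount G Φ m = Bijection (setoid (Fin m)) (CyclesIn G Φ)

------------------------------------------------------------------------
-- Alternating cycles

-- The sequence e₀, …, e₍₂ᵣ₋₁₎ with r = suc half-1, where fwd i = e₂ᵢ and
-- bwd i = e₂ᵢ₊₁.
record AlternatingCycle (G : Digraph) : Set where
  field
    {half-1}     : ℕ
    fwd bwd      : Fin (suc half-1) → Arc G
    distinct     : Injective _≡_ _≡_ [ fwd , bwd ]′
    common-end   : ∀ i → tgt G (fwd i) ≡ tgt G (bwd i)
    common-start : ∀ i → src G (bwd i) ≡ src G (fwd (next i))

  arcCount : ℕ
  arcCount = 2 * suc half-1

  _∈arcs : Pred (Arc G) 0ℓ
  a ∈arcs = ∃[ i ] [ fwd , bwd ]′ i ≡ a

AllACsHave6Arcs : Digraph → Set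
AllACsHave6Arcs G = ∀ (c : AlternatingCycle G) → AlternatingCycle.arcCount c ≡ 6

------------------------------------------------------------------------
-- Factors and routes

module _ (G : Digraph) (Φ : Arc G → Bool) where

  IsFactor : Set
  IsFactor = ∀ (c : AlternatingCycle G) → let open AlternatingCycle c in
    (∀ i → Φ (fwd i) ≡ true  × Φ (bwd i) ≡ false) ⊎
    (∀ i → Φ (fwd i) ≡ false × Φ (bwd i) ≡ true)

  IsOpenFactor : Set
  IsOpenFactor = IsFactor × ¬ Setoid.Carrier (CyclesIn G Φ)

  Step : Vertex G → Vertex G → Set
  Step u v = ∃[ a ] T (Φ a) × src G a ≡ u × tgt G a ≡ v

IsOpen : Digraph → Set
IsOpen G = ∃ (IsOpenFactor G)

IsOdd : Digraph → Set
IsOdd G = ∀ Φ → IsFactor G Φ → ∃[ m ] HasCycleCount G Φ m × parity m ≡ 1ℙ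

record Labelling (G : Digraph) (n : ℕ) : Set where
  field
    entry : Fin n ↔ Entry G
    exit  : Fin n ↔ Exit G

module _ {G : Digraph} {n : ℕ} (ℓ : Labelling G n) where

  private
    entryᵥ exitᵥ : Fin n → Vertex G
    entryᵥ = proj₁ ∘ Inverse.to (Labelling.entry ℓ)
    exitᵥ  = proj₁ ∘ Inverse.to (Labelling.exit ℓ)

  -- In a factor every vertex has at most one outgoing arc and an exit vertex
  -- has none, so a walk from an entry vertex to an exit vertex is the whole
  -- path starting at that entry vertex.
  IsRoute : (Arc G → Bool) → Pred (Permutation′ n) 0ℓ
  IsRoute Φ σ = ∀ i → Star (Step G Φ) (entryᵥ i) (exitᵥ (σ ⟨$⟩ʳ i))

  IsOpenRoute : Pred (Permutation′ n) 0ℓ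
  IsOpenRoute σ = ∃[ Φ ] IsOpenFactor G Φ × IsRoute Φ σ

-- The residue R_F with respect to a labelling of F.
R : ∀ {F n} → Labelling F n → Pred (Permutation′ n) 0ℓ
R ℓ = Residue (IsOpenRoute ℓ)

-- F′ ∼ F, for given labellings.
Similar : ∀ {F′ F n} → Labelling F′ n → Labelling F n → Set
Similar ℓ′ ℓ = ∃[ x ] ∃[ y ] R ℓ ≐ (x · R ℓ′ · y)

------------------------------------------------------------------------
-- Subgraphs

-- A set of alternating cycles, given by the union of their arc sets.
record ACSet (G : Digraph) : Set where
  field
    member : Arc G → Bool
    closed : ∀ (c : AlternatingCycle G) {a b} → let open AlternatingCycle c in
             a ∈arcs → b ∈arcs → member a ≡ member b

  IsNonEmpty : Set
  IsNonEmpty = Σ[ c ∈ AlternatingCycle G ] let open AlternatingCycle c in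
    (∀ {a} → a ∈arcs → T (member a))

open ACSet using (member; IsNonEmpty)

∁ : ∀ {G} → ACSet G → ACSet G
∁ K = record
  { member = not ∘ member K
  ; closed = λ c p q → cong not (ACSet.closed K c p q)
  }

IsProper : ∀ {G} → ACSet G → Set
IsProper K = IsNonEmpty (∁ K)

induced : (G : Digraph) → ACSet G → Digraph
induced G K = record
  { Vertex        = Σ[ v ∈ Vertex G ] True (endpoint? v)
  ; Arc           = Σ[ a ∈ Arc G ] T (member K a)
  ; vertex-finite = Σ-finite (Digraph.vertex-finite G) (λ v → ⌊ endpoint? v ⌋)
  ; arc-finite    = Σ-finite (Digraph.arc-finite G) (member K)
  ; src           = λ (a , k) → src G a , fromWitness (a , k , inj₁ refl)
  ; tgt           = λ (a , k) → tgt G a , fromWitness (a , k , inj₂ refl)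
  }
  where
  open Digraph G using (_≟ᵥ_)

  Endpoint : Vertex G → Set
  Endpoint v = ∃[ a ] T (member K a) × (src G a ≡ v ⊎ tgt G a ≡ v)

  endpoint? : ∀ v → Dec (Endpoint v)
  endpoint? v = Finite.any? (Digraph.arc-finite G)
    (λ a → T? (member K a) ×-dec ((src G a ≟ᵥ v) ⊎-dec (tgt G a ≟ᵥ v)))

------------------------------------------------------------------------
-- Replacement

data Glue (H F′ : Digraph)
          (α : Exit H ↔ Entry F′) (β : Exit F′ ↔ Entry H) :
          Vertex H ⊎ Vertex F′ → Vertex H ⊎ Vertex F′ → Set where
  H-exit~F′-entry : ∀ x → Glue H F′ α β (inj₁ (proj₁ x)) (inj₂ (proj₁ (Inverse.to α x)))
  H-entry~F′-exit : ∀ x → Glue H F′ α β (inj₁ (proj₁ (Inverse.to β x))) (inj₂ (proj₁ x))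

-- G′ is the disjoint union of H and F′ with the exit vertices of each identified
-- with the entry vertices of the other: its vertices are the quotient of those
-- of the disjoint union by the equivalence relation that Glue generates.
record IsGluing (H F′ G′ : Digraph) : Set where
  field
    H-exit↔F′-entry : Exit H ↔ Entry F′
    F′-exit↔H-entry : Exit F′ ↔ Entry H
    quotient   : Vertex H ⊎ Vertex F′ → Vertex G′
    surjective : Surjective _≡_ _≡_ quotient
    identifies : ∀ x y → quotient x ≡ quotient y ⇔
                         EqClosure (Glue H F′ H-exit↔F′-entry F′-exit↔H-entry) x y
    arcs       : (Arc H ⊎ Arc F′) ↔ Arc G′
    src-arcs   : ∀ a → src G′ (Inverse.to arcs a) ≡ quotient (map-⊎ (src H) (src F′) a)
    tgt-arcs   : ∀ a → tgt G′ (Inverse.to arcs a) ≡ quotient (map-⊎ (tgt H) (tgt F′) a)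

-- G′ arises from G by replacing the subgraph induced by K with F′.
IsReplacement : (G : Digraph) → ACSet G → (F′ G′ : Digraph) → Set
IsReplacement G K F′ G′ = IsGluing (induced G (∁ K)) F′ G′

{-# OPTIONS --safe #-}
-- G is a gluing of F and its complement H: a Hamiltonian cycle of G is a factor
-- whose parts in F and H are open, with routes p and q such that pq is a full
-- cycle, i.e. q lies in E_P for the set P of open routes of F.  The cycles of
-- the factor obtained from any two open routes p and q correspond to the cycles
-- of pq, so oddness of G fixes the parity of every open route q of H, and G is
-- Hamiltonian iff some q avoids the residue R_F.  Gluing F′ in along the
-- permutations x and y carries R_F to R_F′.  When the residues are empty, x and
-- y need not preserve the parity condition, and a transposition may have to be
-- inserted.  Since Hamiltonicity is decidable, it suffices to refute that
-- neither of the two gluings is H-equivalent to G.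

module Submission where

open import Defs
open import Data.Bool.Base using (Bool; true; false; not; _∧_; _xor_; T; if_then_else_)
open import Data.Bool.Properties as Bool using (∧-zeroʳ; not-involutive; not-injective)
open import Data.Empty using (⊥)
open import Data.Fin.Base using (Fin; zero; suc; toℕ; punchOut; punchIn; inject₁; fromℕ)
open import Data.Fin.Induction using (<-weakInduction)
open import Data.Fin.Patterns using (0F; 1F)
open import Data.Fin.Permutation as Perm
  using ( Permutation; Permutation′; _⟨$⟩ʳ_; _⟨$⟩ˡ_; _∘ₚ_; flip; _≈_; lift₀; remove; transpose
        ; inverseˡ; inverseʳ; permutation; ↔⇒≡
        )
import Data.Fin.Properties as Fin
open import Data.List.Base using ([]; _∷_; length; filter; map; tabulate; cartesianProduct; _++_)
open import Data.List.Membership.Propositional using (_∈_)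
open import Data.List.Membership.Propositional.Properties using (∈-filter⁺; ∈-filter⁻)
open import Data.List.Properties using (filter-++; length-++; map-tabulate)
open import Data.List.Relation.Unary.All using ([]; _∷_)
open import Data.List.Relation.Unary.AllPairs using ([]; _∷_)
open import Data.List.Relation.Unary.Any using (here; there)
open import Data.List.Relation.Unary.Unique.Propositional using (Unique)
import Data.List.Relation.Unary.Unique.Propositional.Properties as Unique
open import Data.Nat.Base using (ℕ; zero; suc; _+_; _<ᵇ_; parity; _<_; _≤_; s≤s)
open import Data.Nat.DivMod using (m<n⇒m%n≡m; n%n≡0)
open import Data.Nat.GeneralisedArithmetic using (fold)
import Data.Nat.Properties as ℕ
open import Data.Parity.Base as ℙ using (Parity; 0ℙ; 1ℙ)
import Data.Parity.Properties as ℙ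
open import Data.Product.Base using (Σ; ∃; ∃-syntax; Σ-syntax; _×_; _,_; proj₁; proj₂)
open import Data.Sum.Base using (_⊎_; inj₁; inj₂; [_,_]′)
open import Data.Sum.Function.Propositional using (_⊎-↔_)
open import Data.Unit.Base using (tt)
import Data.Vec.Functional as Vector
open import Function.Base using (_∘_; id)
open import Function.Bundles using (Inverse; Injection; _↔_; mk⇔; Equivalence; Bijection; mk↔ₛ′)
open import Function.Construct.Composition using (_↔-∘_)
open import Function.Construct.Identity using (↔-id)
open import Function.Construct.Symmetry using (↔-sym)
open import Function.Definitions using (Injective)
open import Function.Properties.Inverse using (Inverse⇒Injection)
open import Relation.Binary.Bundles using (Setoid)
open import Relation.Binary.Construct.Closure.Equivalence as Eq using (EqClosure)
open import Relation.Binary.Construct.Closure.ReflexiveTransitive using (Star; ε; _◅_; gmap)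
import Relation.Binary.Construct.Closure.Symmetric as Sym
open import Relation.Binary.Definitions using (tri<; tri≈; tri>)
open import Relation.Binary.PropositionalEquality
open import Relation.Nullary using (¬_; Dec; yes; no; does; contradiction)
open import Relation.Nullary.Decidable
  using ( dec-true; dec-false; does-⇔; ⌊_⌋; toWitness; fromWitness; T?; False; fromWitnessFalse
        ; toWitnessFalse; _×-dec_; map′; _→-dec_
        )
open import Relation.Unary using (_≐_)
open import Algebra.Properties.CommutativeMonoid.Sum ℕ.+-0-commutativeMonoid
  using (sum; sum-cong-≗; ∑-distrib-+; ∑-comm; sum-permute; sum-replicate-zero)

open Digraph using (Vertex; Arc; src; tgt; Entry; Exit; vertex-finite; arc-finite; IsEntry; IsExit; IsSaturated)
open ACSet using (member)

-- Signs

-- The two directions are not symmetric. Since `G` is odd, every open route q of H has the parity of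
-- R_F, so q outside E_P means q in R_F; hence a non-Hamiltonian `G` passes to the first gluing for
-- any signs of x and y. Conversely, a route q in E_P is only known to lie outside R_F, and x⁻¹qy⁻¹
-- may then miss R_F′ by having the wrong parity rather than by lying in E_P′. A member τ of R_F′
-- would exclude this: xτy lies in R_F and so has the parity of q, whence τ has the parity of
-- x⁻¹qy⁻¹. So the bad case occurs only if R_F′ is empty; then all permutations of the right parity
-- lie in E_P′, and one transposition repairs the sign.
--
-- Parities and cycle counts are tied together by the congruence of sgn σ and n + (number of cycles
-- of σ) modulo 2, which has to be derived for a sign that is defined by counting inversions.

bit : Bool → ℕ
bit true  = 1
bit false = 0

-- This is the Boolean to which `does (i Fin.<? j)` computes, so that `inversions` turns into a
-- double sum of bits by definitional unfolding.
_<ᶠ_ : ∀ {n} → Fin n → Fin n → Bool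
i <ᶠ j = toℕ i <ᵇ toℕ j

<ᶠ-flip : ∀ {n} {i j : Fin n} → i ≢ j → (j <ᶠ i) ≡ not (i <ᶠ j)
<ᶠ-flip {i = zero}  {zero}  i≢j = contradiction refl i≢j
<ᶠ-flip {i = zero}  {suc j} i≢j = refl
<ᶠ-flip {i = suc i} {zero}  i≢j = refl
<ᶠ-flip {i = suc i} {suc j} i≢j = <ᶠ-flip (i≢j ∘ cong suc)

<ᶠ-irrefl : ∀ {n} (i : Fin n) → (i <ᶠ i) ≡ false
<ᶠ-irrefl zero    = refl
<ᶠ-irrefl (suc i) = <ᶠ-irrefl i

⟨$⟩ʳ-injective : ∀ {n} (σ : Permutation′ n) {i j} → σ ⟨$⟩ʳ i ≡ σ ⟨$⟩ʳ j → i ≡ j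
⟨$⟩ʳ-injective σ eq = trans (sym (inverseˡ σ)) (trans (cong (σ ⟨$⟩ˡ_) eq) (inverseˡ σ))

length-filter-tabulate : ∀ {A : Set} {P : A → Set} (P? : ∀ x → Dec (P x)) {n} (f : Fin n → A) →
  length (filter P? (tabulate f)) ≡ sum (λ i → bit (does (P? (f i))))
length-filter-tabulate P? {zero}  f = refl
length-filter-tabulate P? {suc n} f with does (P? (f zero))
... | true  = cong suc (length-filter-tabulate P? (f ∘ suc))
... | false = length-filter-tabulate P? (f ∘ suc)

length-filter-cartesianProduct : ∀ {A B : Set} {P : A × B → Set} (P? : ∀ x → Dec (P x))
  {m n} (f : Fin m → A) (g : Fin n → B) →
  length (filter P? (cartesianProduct (tabulate f) (tabulate g))) ≡
  sum (λ i → sum (λ j → bit (does (P? (f i , g j)))))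
length-filter-cartesianProduct P? {zero}  f g = refl
length-filter-cartesianProduct P? {suc m} f g = begin
  length (filter P? (row ++ rest))                  ≡⟨ cong length (filter-++ P? row rest) ⟩
  length (filter P? row ++ filter P? rest)          ≡⟨ length-++ (filter P? row) ⟩
  length (filter P? row) + length (filter P? rest)  ≡⟨ cong₂ _+_ row-sum (length-filter-cartesianProduct P? (f ∘ suc) g) ⟩
  _                                                 ∎
  where
  open ≡-Reasoning
  row  = map (f zero ,_) (tabulate g)
  rest = cartesianProduct (tabulate (f ∘ suc)) (tabulate g)

  row-sum : length (filter P? row) ≡ sum (λ j → bit (does (P? (f zero , g j))))
  row-sum = trans (cong (length ∘ filter P?) (map-tabulate g (f zero ,_)))
                  (length-filter-tabulate P? ((f zero ,_) ∘ g))

∑∑ : ∀ {n} → (Fin n → Fin n → ℕ) → ℕ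
∑∑ f = sum (λ i → sum (f i))

∑∑-cong : ∀ {n} {f g : Fin n → Fin n → ℕ} → (∀ i j → f i j ≡ g i j) → ∑∑ f ≡ ∑∑ g
∑∑-cong f≗g = sum-cong-≗ (λ i → sum-cong-≗ (f≗g i))

∑∑-distrib-+ : ∀ {n} (f g : Fin n → Fin n → ℕ) → ∑∑ (λ i j → f i j + g i j) ≡ ∑∑ f + ∑∑ g
∑∑-distrib-+ f g = trans (sum-cong-≗ (λ i → ∑-distrib-+ (f i) (g i)))
                         (∑-distrib-+ (sum ∘ f) (sum ∘ g))

∑∑-permute : ∀ {n} (f : Fin n → Fin n → ℕ) (τ : Permutation′ n) →
  ∑∑ f ≡ ∑∑ (λ i j → f (τ ⟨$⟩ʳ i) (τ ⟨$⟩ʳ j))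
∑∑-permute f τ = trans (sum-permute (sum ∘ f) τ)
                       (sum-cong-≗ (λ i → sum-permute (f (τ ⟨$⟩ʳ i)) τ))

-- For a tournament L, a symmetric h is summed over L exactly half as often as
-- over all ordered pairs.
∑∑-tournament : ∀ {n} (L h : Fin n → Fin n → Bool) →
  (∀ {i j} → i ≢ j → L j i ≡ not (L i j)) → (∀ i j → h j i ≡ h i j) → (∀ i → h i i ≡ false) →
  let total = ∑∑ (λ i j → bit (L i j ∧ h i j)) in total + total ≡ ∑∑ (λ i j → bit (h i j))
∑∑-tournament L h L-flip h-sym h-irr = begin
  total + total                   ≡⟨ cong (total +_) (∑-comm f) ⟩
  total + ∑∑ (λ i j → f j i)      ≡⟨ ∑∑-distrib-+ f (λ i j → f j i) ⟨
  ∑∑ (λ i j → f i j + f j i)      ≡⟨ ∑∑-cong pointwise ⟩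
  ∑∑ (λ i j → bit (h i j))        ∎
  where
  open ≡-Reasoning
  f = λ i j → bit (L i j ∧ h i j)
  total = ∑∑ f

  split : ∀ l b → bit (l ∧ b) + bit (not l ∧ b) ≡ bit b
  split true  b = ℕ.+-identityʳ (bit b)
  split false b = refl

  pointwise : ∀ i j → f i j + f j i ≡ bit (h i j)
  pointwise i j with i Fin.≟ j
  ... | yes refl rewrite h-irr i | ∧-zeroʳ (L i i) = refl
  ... | no i≢j rewrite L-flip i≢j | h-sym i j = split (L i j) (h i j)

+-double-injective : ∀ {m n} → m + m ≡ n + n → m ≡ n
+-double-injective {m} {n} eq = ℕ.*-cancelˡ-≡ m n 2
  (trans (cong (m +_) (ℕ.+-identityʳ m)) (trans eq (cong (n +_) (sym (ℕ.+-identityʳ n)))))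

-- The condition counted by `inversions` depends on the order of the pair. The exclusive or agrees
-- with it for i < j, but is symmetric and vanishes on the diagonal, as `∑∑-tournament` requires.
inverts : ∀ {n} → Permutation′ n → Fin n → Fin n → Bool
inverts σ i j = (i <ᶠ j) xor ((σ ⟨$⟩ʳ i) <ᶠ (σ ⟨$⟩ʳ j))

inversions-∑∑ : ∀ {n} (σ : Permutation′ n) →
  inversions σ ≡ ∑∑ (λ i j → bit ((i <ᶠ j) ∧ ((σ ⟨$⟩ʳ j) <ᶠ (σ ⟨$⟩ʳ i))))
inversions-∑∑ {n} σ = length-filter-cartesianProduct _ {n} {n} id id

inversions-inverts : ∀ {n} (σ : Permutation′ n) →
  inversions σ ≡ ∑∑ (λ i j → bit ((i <ᶠ j) ∧ inverts σ i j))
inversions-inverts σ = trans (inversions-∑∑ σ) (∑∑-cong pointwise)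
  where
  lem : ∀ l {b c} → c ≡ not b → bit (l ∧ c) ≡ bit (l ∧ (l xor b))
  lem true  refl = refl
  lem false eq   = refl

  pointwise : ∀ i j → bit ((i <ᶠ j) ∧ ((σ ⟨$⟩ʳ j) <ᶠ (σ ⟨$⟩ʳ i))) ≡ bit ((i <ᶠ j) ∧ inverts σ i j)
  pointwise i j with i Fin.≟ j
  ... | yes refl rewrite <ᶠ-irrefl i = refl
  ... | no i≢j   = lem (i <ᶠ j) (<ᶠ-flip (i≢j ∘ ⟨$⟩ʳ-injective σ))

inverts-sym : ∀ {n} (σ : Permutation′ n) i j → inverts σ j i ≡ inverts σ i j
inverts-sym σ i j with i Fin.≟ j
... | yes refl = refl
... | no i≢j rewrite <ᶠ-flip i≢j | <ᶠ-flip (i≢j ∘ ⟨$⟩ʳ-injective σ)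
  with i <ᶠ j
...   | true  = refl
...   | false = not-involutive _

inverts-irrefl : ∀ {n} (σ : Permutation′ n) i → inverts σ i i ≡ false
inverts-irrefl σ i rewrite <ᶠ-irrefl i | <ᶠ-irrefl (σ ⟨$⟩ʳ i) = refl

-- Reindexing by τ replaces the order i < j by the tournament τ i < τ j. Both tournaments give half
-- of the same sum over all ordered pairs, so the original order may be restored.
inversions-via : ∀ {n} (τ σ : Permutation′ n) →
  inversions σ ≡ ∑∑ (λ i j → bit ((i <ᶠ j) ∧ inverts σ (τ ⟨$⟩ʳ i) (τ ⟨$⟩ʳ j)))
inversions-via τ σ = trans (trans (inversions-inverts σ) (∑∑-permute _ τ))
  (+-double-injective (trans
    (∑∑-tournament (λ i j → (τ ⟨$⟩ʳ i) <ᶠ (τ ⟨$⟩ʳ j)) k (λ i≢j → <ᶠ-flip (i≢j ∘ ⟨$⟩ʳ-injective τ)) k-sym k-irr)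
    (sym (∑∑-tournament _<ᶠ_ k <ᶠ-flip k-sym k-irr))))
  where
  k     = λ i j → inverts σ (τ ⟨$⟩ʳ i) (τ ⟨$⟩ʳ j)
  k-sym = λ i j → inverts-sym σ (τ ⟨$⟩ʳ i) (τ ⟨$⟩ʳ j)
  k-irr = λ i → inverts-irrefl σ (τ ⟨$⟩ʳ i)

parity-+-double : ∀ m k → parity (m + (k + k)) ≡ parity m
parity-+-double m k = begin
  parity (m + (k + k))                     ≡⟨ ℙ.+-homo-+ m (k + k) ⟩
  parity m ℙ.+ parity (k + k)              ≡⟨ cong (parity m ℙ.+_) (ℙ.+-homo-+ k k) ⟩
  parity m ℙ.+ (parity k ℙ.+ parity k)     ≡⟨ cong (parity m ℙ.+_) (ℙ.p+p≡0ℙ (parity k)) ⟩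
  parity m ℙ.+ 0ℙ                          ≡⟨ ℙ.+-identityʳ (parity m) ⟩
  parity m                                 ∎
  where open ≡-Reasoning

-- The number of inverted pairs is additive up to the pairs inverted twice.
sgn-∘ₚ : ∀ {n} (τ σ : Permutation′ n) → sgn (τ ∘ₚ σ) ≡ sgn τ ℙ.+ sgn σ
sgn-∘ₚ τ σ = begin
  sgn (τ ∘ₚ σ)                            ≡⟨ parity-+-double (inversions (τ ∘ₚ σ)) M ⟨
  parity (inversions (τ ∘ₚ σ) + (M + M))  ≡⟨ cong parity counts ⟩
  parity (inversions τ + inversions σ)    ≡⟨ ℙ.+-homo-+ (inversions τ) (inversions σ) ⟩
  sgn τ ℙ.+ sgn σ                         ∎
  where
  open ≡-Reasoning
  u v w m : Fin _ → Fin _ → ℕ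
  u i j = bit ((i <ᶠ j) ∧ inverts (τ ∘ₚ σ) i j)
  v i j = bit ((i <ᶠ j) ∧ inverts τ i j)
  w i j = bit ((i <ᶠ j) ∧ inverts σ (τ ⟨$⟩ʳ i) (τ ⟨$⟩ʳ j))
  m i j = bit ((i <ᶠ j) ∧ inverts τ i j ∧ inverts σ (τ ⟨$⟩ʳ i) (τ ⟨$⟩ʳ j))
  M = ∑∑ m

  xor-count : ∀ x y z → bit (x ∧ (x xor z)) + (bit (x ∧ (x xor y) ∧ (y xor z)) + bit (x ∧ (x xor y) ∧ (y xor z)))
                      ≡ bit (x ∧ (x xor y)) + bit (x ∧ (y xor z))
  xor-count false y     z     = refl
  xor-count true  false false = refl
  xor-count true  false true  = refl
  xor-count true  true  false = refl
  xor-count true  true  true  = refl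

  counts : inversions (τ ∘ₚ σ) + (M + M) ≡ inversions τ + inversions σ
  counts = begin
    inversions (τ ∘ₚ σ) + (M + M)            ≡⟨ cong₂ _+_ (inversions-inverts (τ ∘ₚ σ)) (sym (∑∑-distrib-+ m m)) ⟩
    ∑∑ u + ∑∑ (λ i j → m i j + m i j)        ≡⟨ ∑∑-distrib-+ u (λ i j → m i j + m i j) ⟨
    ∑∑ (λ i j → u i j + (m i j + m i j))     ≡⟨ ∑∑-cong (λ i j → xor-count (i <ᶠ j) ((τ ⟨$⟩ʳ i) <ᶠ (τ ⟨$⟩ʳ j)) ((σ ⟨$⟩ʳ (τ ⟨$⟩ʳ i)) <ᶠ (σ ⟨$⟩ʳ (τ ⟨$⟩ʳ j)))) ⟩
    ∑∑ (λ i j → v i j + w i j)               ≡⟨ ∑∑-distrib-+ v w ⟩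
    ∑∑ v + ∑∑ w                              ≡⟨ cong₂ _+_ (inversions-inverts τ) (inversions-via τ σ) ⟨
    inversions τ + inversions σ              ∎

sgn-cong : ∀ {n} {σ τ : Permutation′ n} → σ ≈ τ → sgn σ ≡ sgn τ
sgn-cong {σ = σ} {τ} σ≈τ = cong parity (trans (inversions-∑∑ σ) (trans
  (∑∑-cong (λ i j → cong₂ (λ a b → bit ((i <ᶠ j) ∧ (a <ᶠ b))) (σ≈τ j) (σ≈τ i)))
  (sym (inversions-∑∑ τ))))

sgn-lift₀ : ∀ {n} (σ : Permutation′ n) → sgn (lift₀ σ) ≡ sgn σ
sgn-lift₀ {n} σ = cong parity (trans (inversions-∑∑ (lift₀ σ)) (trans
  (cong₂ _+_ (sum-replicate-zero n) refl) (sym (inversions-∑∑ σ))))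

-- Signs of transpositions

sgn-transpose-01 : ∀ n → sgn (transpose {suc (suc n)} zero (suc zero)) ≡ 1ℙ
sgn-transpose-01 n = cong parity (begin
  inversions t                   ≡⟨ inversions-∑∑ t ⟩
  row 0F + (row 1F + rest)       ≡⟨ cong₂ (λ a b → suc a + (b + rest)) zeros zeros ⟩
  1 + (0 + rest)                 ≡⟨ cong suc (trans (sum-cong-≗ rest-row) zeros) ⟩
  1                              ∎)
  where
  open ≡-Reasoning
  t = transpose {suc (suc n)} zero (suc zero)

  row : Fin (suc (suc n)) → ℕ
  row i = sum (λ j → bit ((i <ᶠ j) ∧ ((t ⟨$⟩ʳ j) <ᶠ (t ⟨$⟩ʳ i))))

  rest = sum (λ i → row (suc (suc i)))

  zeros : sum {n} (λ _ → 0) ≡ 0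
  zeros = sum-replicate-zero n

  antisym : ∀ {n} (i j : Fin n) → bit ((i <ᶠ j) ∧ (j <ᶠ i)) ≡ 0
  antisym i j with i Fin.≟ j
  ... | yes refl rewrite <ᶠ-irrefl i = refl
  ... | no i≢j rewrite <ᶠ-flip i≢j with i <ᶠ j
  ...   | true  = refl
  ...   | false = refl

  rest-row : ∀ i → row (suc (suc i)) ≡ 0
  rest-row i = trans (sum-cong-≗ (antisym i)) zeros

parity-suc : ∀ n → parity (suc n) ≡ 1ℙ ℙ.+ parity n
parity-suc = ℙ.+-homo-+ 1

transpose-source : ∀ {n} (i j : Fin n) → transpose i j ⟨$⟩ʳ i ≡ j
transpose-source i j rewrite dec-true (i Fin.≟ i) refl = refl

transpose-target : ∀ {n} (i j : Fin n) → transpose i j ⟨$⟩ʳ j ≡ i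
transpose-target i j with j Fin.≟ i
... | yes j≡i = j≡i
... | no _ rewrite dec-true (j Fin.≟ j) refl = refl

transpose-other : ∀ {n} (i j : Fin n) {k} → k ≢ i → k ≢ j → transpose i j ⟨$⟩ʳ k ≡ k
transpose-other i j {k} k≢i k≢j
  rewrite dec-false (k Fin.≟ i) k≢i | dec-false (k Fin.≟ j) k≢j = refl

-- The involution `lift₀ (transpose zero b)` exchanges 1 and `suc b`. Conjugation by it reduces the
-- sign of any transposition moving zero to that of (0 1), whose inversions are easily counted.
transpose-0-conjugate : ∀ {n} (b : Fin (suc n)) → let π = lift₀ (transpose zero b) in
  transpose zero (suc b) ≈ (π ∘ₚ (transpose zero (suc zero) ∘ₚ π))
transpose-0-conjugate b zero = refl
transpose-0-conjugate {n} b (suc j) = by-cases j (j Fin.≟ b)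
  where
  τ = transpose zero (suc b)
  t = transpose {suc (suc n)} zero (suc zero)
  π = lift₀ (transpose zero b)

  by-cases : ∀ j → Dec (j ≡ b) → τ ⟨$⟩ʳ suc j ≡ π ⟨$⟩ʳ (t ⟨$⟩ʳ (π ⟨$⟩ʳ suc j))
  by-cases j (yes refl) = trans (transpose-target zero (suc b))
    (sym (cong (λ i → π ⟨$⟩ʳ (t ⟨$⟩ʳ suc i)) (transpose-target zero b)))
  by-cases zero (no 0≢b) = trans (transpose-other zero (suc b) (λ ()) (0≢b ∘ Fin.suc-injective))
    (sym (trans (cong (λ i → π ⟨$⟩ʳ i) (transpose-other zero (suc zero) (λ ()) (0≢b ∘ sym ∘ Fin.suc-injective)))
                (cong suc (transpose-target zero b))))
  by-cases (suc j) (no j≢b) = trans (transpose-other zero (suc b) (λ ()) (j≢b ∘ Fin.suc-injective))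
    (sym (trans (cong (λ i → π ⟨$⟩ʳ (t ⟨$⟩ʳ suc i)) fixed) (cong suc fixed)))
    where
    fixed : transpose zero b ⟨$⟩ʳ suc j ≡ suc j
    fixed = transpose-other zero b (λ ()) j≢b

sgn-transpose-0 : ∀ {n} (b : Fin n) → sgn (transpose zero (suc b)) ≡ 1ℙ
sgn-transpose-0 {suc n} b = begin
  sgn (transpose zero (suc b))         ≡⟨ sgn-cong {σ = transpose zero (suc b)} {π ∘ₚ (t ∘ₚ π)} (transpose-0-conjugate b) ⟩
  sgn (π ∘ₚ (t ∘ₚ π))                  ≡⟨ sgn-∘ₚ π (t ∘ₚ π) ⟩
  sgn π ℙ.+ sgn (t ∘ₚ π)               ≡⟨ cong (sgn π ℙ.+_) (sgn-∘ₚ t π) ⟩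
  sgn π ℙ.+ (sgn t ℙ.+ sgn π)          ≡⟨ cong (λ s → sgn π ℙ.+ (s ℙ.+ sgn π)) (sgn-transpose-01 n) ⟩
  sgn π ℙ.+ (1ℙ ℙ.+ sgn π)             ≡⟨ ℙ.p+p⁻¹≡1ℙ (sgn π) ⟩
  1ℙ                                   ∎
  where
  open ≡-Reasoning
  π = lift₀ (transpose zero b)
  t = transpose {suc (suc n)} zero (suc zero)

-- Cycles of a permutation and its sign

Invariant : {A : Set} → (A → A) → (A → Bool) → Set
Invariant f g = ∀ x → g (f x) ≡ g x

-- For a permutation of a finite set this says that x and y lie on one cycle: the indicator function
-- of the cycle of x is itself an invariant.
Linked : {A : Set} → (A → A) → A → A → Set
Linked f x y = ∀ {g} → Invariant f g → g x ≡ g y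

-- Belonging to the same cycle is expressed through invariant functions instead
-- of orbits, because those extend directly when a point is added to a cycle.
record Cycles {n} (σ : Permutation′ n) (k : ℕ) : Set where
  field
    index      : Fin n → Fin k
    surjective : ∀ c → ∃[ i ] index i ≡ c
    invariant  : ∀ i → index (σ ⟨$⟩ʳ i) ≡ index i
    separates  : ∀ {i j} → index i ≡ index j → Linked (σ ⟨$⟩ʳ_) i j

extend : ∀ {n} → Bool → (Fin n → Bool) → Fin (suc n) → Bool
extend b g zero    = b
extend b g (suc i) = g i

remove-0 : ∀ {n} (ρ : Permutation′ (suc n)) → ρ ⟨$⟩ʳ zero ≡ zero →
           ∀ i → suc (remove zero ρ ⟨$⟩ʳ i) ≡ ρ ⟨$⟩ʳ suc i
remove-0 ρ ρ0≡0 i = Perm.lift₀-remove ρ ρ0≡0 (suc i)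

sgn-remove-0 : ∀ {n} (ρ : Permutation′ (suc n)) → ρ ⟨$⟩ʳ zero ≡ zero → sgn (remove zero ρ) ≡ sgn ρ
sgn-remove-0 ρ ρ0≡0 = trans (sym (sgn-lift₀ (remove zero ρ)))
  (sgn-cong {σ = lift₀ (remove zero ρ)} {ρ} (Perm.lift₀-remove ρ ρ0≡0))

module _ {n k} (σ : Permutation′ (suc n)) (σ0≡0 : σ ⟨$⟩ʳ zero ≡ zero) (C : Cycles σ (suc k)) where
  open Cycles C

  private
    isZero : Fin (suc n) → Bool
    isZero = extend true (λ _ → false)

    isZero-invariant : Invariant (σ ⟨$⟩ʳ_) isZero
    isZero-invariant zero = cong isZero σ0≡0
    isZero-invariant (suc i) with σ ⟨$⟩ʳ suc i in eq
    ... | zero  with () ← ⟨$⟩ʳ-injective σ (trans eq (sym σ0≡0))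
    ... | suc _ = refl

    0≢suc : ∀ i → index zero ≢ index (suc i)
    0≢suc i eq with () ← separates {zero} {suc i} eq isZero-invariant

  -- The indicator of zero is invariant, so zero is alone in its class and that class can be punched
  -- out. An invariant function on the rest extends with an arbitrary value at zero.
  remove-fixed-0 : Cycles (remove zero σ) k
  remove-fixed-0 = record
    { index      = λ i → punchOut (0≢suc i)
    ; surjective = surj
    ; invariant  = λ i → Fin.punchOut-cong (index zero)
                     (trans (cong index (remove-0 σ σ0≡0 i)) (invariant (suc i)))
    ; separates  = λ {i} {j} eq {g} g-inv →
        separates {suc i} {suc j} (Fin.punchOut-injective (0≢suc i) (0≢suc j) eq)
          (extended g g-inv)
    }
    where
    surj : ∀ c → ∃[ i ] punchOut (0≢suc i) ≡ c
    surj c with surjective (punchIn (index zero) c)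
    ... | zero  , eq = contradiction (sym eq) (Fin.punchInᵢ≢i (index zero) c)
    ... | suc i , eq = i , trans (Fin.punchOut-cong (index zero) {i≢k = Fin.punchInᵢ≢i (index zero) c ∘ sym} eq) (Fin.punchOut-punchIn (index zero))

    extended : ∀ g → Invariant (remove zero σ ⟨$⟩ʳ_) g →
               Invariant (σ ⟨$⟩ʳ_) (extend false g)
    extended g g-inv zero = cong (extend false g) σ0≡0
    extended g g-inv (suc i) = trans (cong (extend false g) (sym (remove-0 σ σ0≡0 i))) (g-inv i)

module _ {n k} (σ : Permutation′ (suc n)) {b} (σ0≡b : σ ⟨$⟩ʳ zero ≡ suc b) (C : Cycles σ k) where
  open Cycles C

  -- Zero is bypassed: its predecessor is sent straight to `suc b`. Deleting the resulting fixed
  -- point shortens one cycle but keeps the number of cycles, at the price of one transposition in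
  -- the sign.
  contract-0 : Permutation′ (suc n)
  contract-0 = σ ∘ₚ transpose zero (suc b)

  contract-0-fixes : contract-0 ⟨$⟩ʳ zero ≡ zero
  contract-0-fixes = trans (cong (transpose zero (suc b) ⟨$⟩ʳ_) σ0≡b) (transpose-target zero (suc b))

  private
    ρ : Permutation′ n
    ρ = remove zero contract-0

    ρ-spec : ∀ i → suc (ρ ⟨$⟩ʳ i) ≡ transpose zero (suc b) ⟨$⟩ʳ (σ ⟨$⟩ʳ suc i)
    ρ-spec = remove-0 contract-0 contract-0-fixes

    ρ-skips : ∀ {i} → σ ⟨$⟩ʳ suc i ≡ zero → ρ ⟨$⟩ʳ i ≡ b
    ρ-skips {i} eq = Fin.suc-injective (trans (ρ-spec i)
      (trans (cong (transpose zero (suc b) ⟨$⟩ʳ_) eq) (transpose-source zero (suc b))))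

    ρ-follows : ∀ {i j} → σ ⟨$⟩ʳ suc i ≡ suc j → ρ ⟨$⟩ʳ i ≡ j
    ρ-follows {i} {j} eq = Fin.suc-injective (trans (ρ-spec i)
      (trans (cong (transpose zero (suc b) ⟨$⟩ʳ_) eq) (transpose-other zero (suc b) (λ ()) j≢b)))
      where
      j≢b : suc j ≢ suc b
      j≢b j≡b with () ← ⟨$⟩ʳ-injective σ (trans eq (trans j≡b (sym σ0≡b)))

    index-0 : index zero ≡ index (suc b)
    index-0 = trans (sym (invariant zero)) (cong index σ0≡b)

    inv : ∀ i → index (suc (ρ ⟨$⟩ʳ i)) ≡ index (suc i)
    inv i = by-cases (σ ⟨$⟩ʳ suc i) refl
      where
      by-cases : ∀ x → σ ⟨$⟩ʳ suc i ≡ x → index (suc (ρ ⟨$⟩ʳ i)) ≡ index (suc i)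
      by-cases zero eq = trans (cong (index ∘ suc) (ρ-skips eq))
        (trans (sym index-0) (trans (cong index (sym eq)) (invariant (suc i))))
      by-cases (suc j) eq = trans (cong (index ∘ suc) (ρ-follows eq))
        (trans (cong index (sym eq)) (invariant (suc i)))

    -- At zero the function takes the value of the successor `suc b`, as invariance under σ demands.
    extended : ∀ g → Invariant (ρ ⟨$⟩ʳ_) g → Invariant (σ ⟨$⟩ʳ_) (extend (g b) g)
    extended g g-inv zero = cong (extend (g b) g) σ0≡b
    extended g g-inv (suc i) = by-cases (σ ⟨$⟩ʳ suc i) refl
      where
      by-cases : ∀ x → σ ⟨$⟩ʳ suc i ≡ x → extend (g b) g (σ ⟨$⟩ʳ suc i) ≡ g i
      by-cases zero eq = trans (cong (extend (g b) g) eq)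
        (trans (cong g (sym (ρ-skips eq))) (g-inv i))
      by-cases (suc j) eq = trans (cong (extend (g b) g) eq)
        (trans (cong g (sym (ρ-follows eq))) (g-inv i))

  remove-moved-0 : Cycles (remove zero contract-0) k
  remove-moved-0 = record
    { index      = index ∘ suc
    ; surjective = surj
    ; invariant  = inv
    ; separates  = λ {i} {j} eq {g} g-inv → separates {suc i} {suc j} eq (extended g g-inv)
    }
    where
    surj : ∀ c → ∃[ i ] index (suc i) ≡ c
    surj c with surjective c
    ... | zero  , eq = b , trans (sym index-0) eq
    ... | suc i , eq = i , eq

-- Induction by deleting zero. If zero is fixed, n and k both drop by one and the sign stays;
-- otherwise only n drops, and the transposition in `contract-0` flips the sign.
sgn-cycles : ∀ {n k} (σ : Permutation′ n) → Cycles σ k → sgn σ ≡ parity n ℙ.+ parity k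
sgn-cycles {zero} {zero} σ C = refl
sgn-cycles {zero} {suc k} σ C with () ← proj₁ (Cycles.surjective C zero)
sgn-cycles {suc n} {zero} σ C with () ← Cycles.index C zero
sgn-cycles {suc n} {suc k} σ C with σ ⟨$⟩ʳ zero in eq
... | zero = begin
  sgn σ                                     ≡⟨ sgn-remove-0 σ eq ⟨
  sgn (remove zero σ)                       ≡⟨ sgn-cycles (remove zero σ) (remove-fixed-0 σ eq C) ⟩
  parity n ℙ.+ parity k                     ≡⟨ both-flip (parity n) (parity k) ⟨
  (1ℙ ℙ.+ parity n) ℙ.+ (1ℙ ℙ.+ parity k)   ≡⟨ cong₂ ℙ._+_ (parity-suc n) (parity-suc k) ⟨
  parity (suc n) ℙ.+ parity (suc k)         ∎
  where
  open ≡-Reasoning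
  both-flip : ∀ p q → (1ℙ ℙ.+ p) ℙ.+ (1ℙ ℙ.+ q) ≡ p ℙ.+ q
  both-flip 0ℙ 0ℙ = refl
  both-flip 0ℙ 1ℙ = refl
  both-flip 1ℙ 0ℙ = refl
  both-flip 1ℙ 1ℙ = refl
... | suc b = flip-both (begin
  sgn σ ℙ.+ 1ℙ                                ≡⟨ cong (sgn σ ℙ.+_) (sgn-transpose-0 b) ⟨
  sgn σ ℙ.+ sgn (transpose zero (suc b))      ≡⟨ sgn-∘ₚ σ (transpose zero (suc b)) ⟨
  sgn (contract-0 σ eq C)                     ≡⟨ sgn-remove-0 (contract-0 σ eq C) (contract-0-fixes σ eq C) ⟨
  sgn (remove zero (contract-0 σ eq C))       ≡⟨ sgn-cycles (remove zero (contract-0 σ eq C)) (remove-moved-0 σ eq C) ⟩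
  parity n ℙ.+ parity (suc k)                 ∎)
  where
  open ≡-Reasoning
  flip-both : ∀ {s} → s ℙ.+ 1ℙ ≡ parity n ℙ.+ parity (suc k) → s ≡ parity (suc n) ℙ.+ parity (suc k)
  flip-both {s} e rewrite parity-suc n with s | parity n | parity (suc k)
  flip-both refl | 0ℙ | 0ℙ | 1ℙ = refl
  flip-both refl | 0ℙ | 1ℙ | 0ℙ = refl
  flip-both refl | 1ℙ | 0ℙ | 0ℙ = refl
  flip-both refl | 1ℙ | 1ℙ | 1ℙ = refl

-- Orbits and full cycles

next-inject₁ : ∀ {n} (i : Fin n) → next (inject₁ i) ≡ suc i
next-inject₁ {n} i = Fin.toℕ-injective (trans (Fin.toℕ-fromℕ< _)
  (trans (m<n⇒m%n≡m (s≤s (subst (_< n) (sym (Fin.toℕ-inject₁ i)) (Fin.toℕ<n i)))) (cong suc (Fin.toℕ-inject₁ i))))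

next-fromℕ : ∀ n → next (fromℕ n) ≡ zero
next-fromℕ n = Fin.toℕ-injective (trans (Fin.toℕ-fromℕ< _)
  (trans (cong (λ k → suc k Data.Nat.Base.% suc n) (Fin.toℕ-fromℕ n)) (n%n≡0 (suc n))))

next-surjective : ∀ {n} (j : Fin (suc n)) → ∃[ i ] next i ≡ j
next-surjective {n} zero = fromℕ n , next-fromℕ n
next-surjective (suc j)  = inject₁ j , next-inject₁ j

next-induction : ∀ {n} (P : Fin (suc n) → Set) → P zero → (∀ i → P i → P (next i)) → ∀ i → P i
next-induction P P0 step = <-weakInduction P P0 (λ i p → subst P (next-inject₁ i) (step (inject₁ i) p))

next-constant : ∀ {n} {A : Set} (h : Fin (suc n) → A) → (∀ i → h (next i) ≡ h i) → ∀ i → h i ≡ h zero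
next-constant h inv = next-induction (λ i → h i ≡ h zero) refl (λ i eq → trans (inv i) eq)

least : {P : ℕ → Set} → (∀ k → Dec (P k)) → ∀ k → P k → ∃[ m ] P m × (∀ {j} → j < m → ¬ P j)
least {P} P? k pk with go (suc k)
  where
  go : ∀ n → (∀ {j} → j < n → ¬ P j) ⊎ (∃[ m ] P m × (∀ {j} → j < m → ¬ P j))
  go zero = inj₁ λ ()
  go (suc n) with go n
  ... | inj₂ found = inj₂ found
  ... | inj₁ none with P? n
  ...   | yes pn = inj₂ (n , pn , none)
  ...   | no ¬pn = inj₁ λ j<1+n → [ none , (λ { refl → ¬pn }) ]′ (ℕ.m<1+n⇒m<n∨m≡n j<1+n)
... | inj₁ none  = contradiction pk (none ℕ.≤-refl)
... | inj₂ found = found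

↔-injective : {A B : Set} (e : A ↔ B) → Injective _≡_ _≡_ (Inverse.to e)
↔-injective = Injection.injective ∘ Inverse⇒Injection

does-true : {A : Set} (a? : Dec A) → does a? ≡ true → A
does-true (yes a) _ = a

-- Closure in both directions makes the indicator of P an invariant function. This is how
-- linkedness, which quantifies over invariants, yields concrete membership in an orbit or a
-- directed cycle.
linked-transport : {A : Set} {f : A → A} {P : A → Set} → (∀ x → Dec (P x)) →
  (∀ x → P x → P (f x)) → (∀ x → P (f x) → P x) → ∀ {x y} → Linked f x y → P x → P y
linked-transport P? forward backward {x} {y} x~y px =
  does-true (P? y) (trans (sym (x~y invariant)) (dec-true (P? x) px))
  where
  invariant : Invariant _ (does ∘ P?)
  invariant x = does-⇔ (mk⇔ (backward x) (forward x)) (P? _) (P? x)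

record Orbit {A : Set} (f : A → A) (u : A) : Set where
  field
    {length-1} : ℕ
    returns    : fold u f (suc length-1) ≡ u
    injective  : ∀ {i j : Fin (suc length-1)} → fold u f (toℕ i) ≡ fold u f (toℕ j) → i ≡ j

  point : Fin (suc length-1) → A
  point i = fold u f (toℕ i)

  point-next : ∀ i → f (point i) ≡ point (next i)
  point-next i with ℕ.m≤n⇒m<n∨m≡n (ℕ.≤-pred (Fin.toℕ<n i))
  ... | inj₁ i<l = sym (cong (fold u f) (trans (Fin.toℕ-fromℕ< _) (m<n⇒m%n≡m (s≤s i<l))))
  ... | inj₂ i≡l = trans (cong (fold u f ∘ suc) i≡l) (trans returns (sym (cong (fold u f)
    (trans (Fin.toℕ-fromℕ< _) (trans (cong (λ k → suc k Data.Nat.Base.% suc length-1) i≡l) (n%n≡0 (suc length-1)))))))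

module _ {A : Set} (A-finite : Finite A) where
  open Finite A-finite

  module _ (f : A → A) (f-injective : Injective _≡_ _≡_ f) where

    fold-cancel : ∀ {u} i {d} → fold u f (i + d) ≡ fold u f i → fold u f d ≡ u
    fold-cancel zero    eq = eq
    fold-cancel (suc i) eq = fold-cancel i (f-injective eq)

    fold-return : ∀ {u i j} → i < j → fold u f i ≡ fold u f j → ∃[ d ] fold u f (suc d) ≡ u × d < j
    fold-return {u} {i} {j} i<j eq with d , refl ← ℕ.m≤n⇒∃[o]m+o≡n i<j =
      d , fold-cancel i (trans (cong (fold u f) (ℕ.+-suc i d)) (sym eq)) , s≤s (ℕ.m≤n+m d i)

    opaque
      -- The pigeonhole principle gives some return to u, and the least one is taken: a coincidence
      -- among the points before it would cancel, by injectivity, to an earlier return.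
      orbit : ∀ u → Orbit f u
      orbit u with i , j , i<j , eq ← Fin.pigeonhole (ℕ.n<1+n size) (Inverse.to enum ∘ fold u f ∘ toℕ)
        with k , returns-k , _ ← fold-return i<j (↔-injective enum eq)
        with m , returns , minimal ← least (λ d → fold u f (suc d) ≟ u) k returns-k
        = record { returns = returns ; injective = inj }
        where
        distinct : ∀ {i j : Fin (suc m)} → toℕ i < toℕ j → fold u f (toℕ i) ≢ fold u f (toℕ j)
        distinct {i} {j} i<j eq with d , returns-d , d<j ← fold-return i<j eq =
          minimal (ℕ.<-≤-trans d<j (ℕ.≤-pred (Fin.toℕ<n j))) returns-d

        inj : ∀ {i j : Fin (suc m)} → fold u f (toℕ i) ≡ fold u f (toℕ j) → i ≡ j
        inj {i} {j} eq with ℕ.<-cmp (toℕ i) (toℕ j)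
        ... | tri< i<j _ _ = contradiction eq (distinct i<j)
        ... | tri≈ _ i≡j _ = Fin.toℕ-injective i≡j
        ... | tri> _ _ j<i = contradiction (sym eq) (distinct j<i)

      -- The last point of the orbit of u is sent back to u.
      preimage : ∀ u → ∃[ v ] f v ≡ u
      preimage u = _ , Orbit.returns (orbit u)

    orbit-covers : ∀ {u v} (O : Orbit f u) → Linked f u v → ∃[ i ] Orbit.point O i ≡ v
    orbit-covers {u} {v} O u~v = linked-transport {f = f} {λ x → ∃[ i ] point i ≡ x} onOrbit? forward backward {u} {v} u~v (zero , refl)
      where
      open Orbit O

      onOrbit? : ∀ x → Dec (∃[ i ] point i ≡ x)
      onOrbit? x = Fin.any? (λ i → point i ≟ x)

      forward : ∀ x → ∃[ i ] point i ≡ x → ∃[ i ] point i ≡ f x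
      forward x (i , refl) = next i , sym (point-next i)

      backward : ∀ x → ∃[ i ] point i ≡ f x → ∃[ i ] point i ≡ x
      backward x (j , pj≡fx) with i , refl ← next-surjective j =
        i , f-injective (trans (point-next i) pj≡fx)

Fin-finite : ∀ n → Finite (Fin n)
Fin-finite n = record { size = n ; enum = ↔-id (Fin n) }

injective⇒permutation : ∀ {n} (h : Fin n → Fin n) → Injective _≡_ _≡_ h →
                        Σ[ σ ∈ Permutation′ n ] (∀ i → σ ⟨$⟩ʳ i ≡ h i)
injective⇒permutation {n} h h-injective =
  permutation h (proj₁ ∘ pre) (proj₂ ∘ pre) (λ i → h-injective (proj₂ (pre (h i)))) , λ _ → refl
  where pre = preimage (Fin-finite n) h h-injective

connected⇒IsFullCycle : ∀ {n} (σ : Permutation′ n) →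
  (∀ i j → Linked (σ ⟨$⟩ʳ_) i j) → IsFullCycle σ
connected⇒IsFullCycle {zero}  σ _ = σ , λ ()
connected⇒IsFullCycle {suc n} σ connected = relabel (↔⇒≡ c) c Orb.point-next
  where
  σ-injective : Injective _≡_ _≡_ (σ ⟨$⟩ʳ_)
  σ-injective = ⟨$⟩ʳ-injective σ

  module Orb where
    O : Orbit (σ ⟨$⟩ʳ_) zero
    O = orbit (Fin-finite (suc n)) (σ ⟨$⟩ʳ_) σ-injective zero
    open Orbit O public
    covers : ∀ j → ∃[ i ] point i ≡ j
    covers j = orbit-covers (Fin-finite (suc n)) (σ ⟨$⟩ʳ_) σ-injective O (connected zero j)

  c : Permutation (suc Orb.length-1) (suc n)
  c = permutation Orb.point (proj₁ ∘ Orb.covers) (proj₂ ∘ Orb.covers)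
        (λ i → Orb.injective (proj₂ (Orb.covers (Orb.point i))))

  -- The orbit length is known to be n + 1 only once the bijection `c` exists; matching on that
  -- equation makes `c` a permutation of the labels.
  relabel : ∀ {m} → suc m ≡ suc n → (c : Permutation (suc m) (suc n)) →
            (∀ i → σ ⟨$⟩ʳ (c ⟨$⟩ʳ i) ≡ c ⟨$⟩ʳ next i) → IsFullCycle σ
  relabel refl c eq = c , eq

IsFullCycle⇒connected : ∀ {n} (σ : Permutation′ n) → IsFullCycle σ →
  ∀ i j → Linked (σ ⟨$⟩ʳ_) i j
IsFullCycle⇒connected {suc n} σ (c , σc≡c-next) i j {g} inv = trans (const i) (sym (const j))
  where
  const : ∀ i → g i ≡ g (c ⟨$⟩ʳ zero)
  const i = trans (cong g (sym (inverseʳ c)))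
    (next-constant (g ∘ (c ⟨$⟩ʳ_)) (λ k → trans (cong g (sym (σc≡c-next k))) (inv (c ⟨$⟩ʳ k))) (c ⟨$⟩ˡ i))

-- Degrees and alternating cycles

Two : {A : Set} → (A → Set) → Set
Two P = ∃[ x ] ∃[ y ] x ≢ y × P x × P y × (∀ {z} → P z → z ≡ x ⊎ z ≡ y)

module _ {A : Set} {P : A → Set} where

  length-0⇒none : ∀ {xs} → (∀ {x} → P x → x ∈ xs) → length xs ≡ 0 → ∀ {x} → ¬ P x
  length-0⇒none {[]} complete _ px with () ← complete px

  none⇒length-0 : ∀ {xs} → (∀ {x} → x ∈ xs → P x) → (∀ {x} → ¬ P x) → length xs ≡ 0
  none⇒length-0 {[]}    sound none = refl
  none⇒length-0 {_ ∷ _} sound none = contradiction (sound (here refl)) none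

  length-2⇒two : ∀ {xs} → Unique xs → (∀ {x} → x ∈ xs → P x) → (∀ {x} → P x → x ∈ xs) →
                 length xs ≡ 2 → Two P
  length-2⇒two {x ∷ y ∷ []} ((x≢y ∷ []) ∷ _) sound complete _ =
    x , y , x≢y , sound (here refl) , sound (there (here refl)) , cases ∘ complete
    where
    cases : ∀ {z} → z ∈ x ∷ y ∷ [] → z ≡ x ⊎ z ≡ y
    cases (here z≡x)         = inj₁ z≡x
    cases (there (here z≡y)) = inj₂ z≡y

  two⇒length-2 : ∀ {xs} → Unique xs → (∀ {x} → x ∈ xs → P x) → (∀ {x} → P x → x ∈ xs) →
                 Two P → length xs ≡ 2
  two⇒length-2 {xs} unique sound complete (x , y , x≢y , px , py , only) =
    cases unique (only ∘ sound) (complete px) (complete py)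
    where
    cases : ∀ {xs} → Unique xs → (∀ {z} → z ∈ xs → z ≡ x ⊎ z ≡ y) → x ∈ xs → y ∈ xs → length xs ≡ 2
    cases {_ ∷ []} u from (here x≡) (here y≡) = contradiction (trans x≡ (sym y≡)) x≢y
    cases {_ ∷ _ ∷ []} u from mx my = refl
    cases {a ∷ b ∷ c ∷ _} ((a≢b ∷ a≢c ∷ _) ∷ (b≢c ∷ _) ∷ _) from mx my
      with from (here refl) | from (there (here refl)) | from (there (there (here refl)))
    ... | inj₁ refl | inj₁ refl | _         = contradiction refl a≢b
    ... | inj₁ refl | inj₂ refl | inj₁ refl = contradiction refl a≢c
    ... | inj₁ refl | inj₂ refl | inj₂ refl = contradiction refl b≢c
    ... | inj₂ refl | inj₂ refl | _         = contradiction refl a≢b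
    ... | inj₂ refl | inj₁ refl | inj₁ refl = contradiction refl b≢c
    ... | inj₂ refl | inj₁ refl | inj₂ refl = contradiction refl a≢c

module _ {A : Set} (A-finite : Finite A) {P : A → Set} (P? : ∀ x → Dec (P x)) where
  open Finite A-finite

  private
    hits-unique : Unique (filter P? elements)
    hits-unique = Unique.filter⁺ P? (Unique.map⁺ (↔-injective (↔-sym enum)) (Unique.allFin⁺ size))

    hits-complete : ∀ {x} → P x → x ∈ filter P? elements
    hits-complete {x} px = ∈-filter⁺ P? (∈-elements x) px

    hits-sound : ∀ {x} → x ∈ filter P? elements → P x
    hits-sound x∈ = proj₂ (∈-filter⁻ P? {xs = elements} x∈)

  count-0⇒none : length (filter P? elements) ≡ 0 → ∀ {x} → ¬ P x
  count-0⇒none = length-0⇒none hits-complete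

  none⇒count-0 : (∀ {x} → ¬ P x) → length (filter P? elements) ≡ 0
  none⇒count-0 = none⇒length-0 hits-sound

  count-2⇒two : length (filter P? elements) ≡ 2 → Two P
  count-2⇒two = length-2⇒two hits-unique hits-sound hits-complete

  two⇒count-2 : Two P → length (filter P? elements) ≡ 2
  two⇒count-2 = two⇒length-2 hits-unique hits-sound hits-complete

Mate : {A V : Set} → (A → V) → A → Set
Mate end a = ∃[ b ] b ≢ a × end b ≡ end a × (∀ {c} → end c ≡ end a → c ≡ a ⊎ c ≡ b)

two⇒mate : {A V : Set} (end : A → V) {a : A} → Two (λ b → end b ≡ end a) → Mate end a
two⇒mate end (x , y , x≢y , ex , ey , only) with only refl
... | inj₁ refl = y , x≢y ∘ sym , ey , only
... | inj₂ refl = x , x≢y , ex , λ eq → [ inj₂ , inj₁ ]′ (only eq)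

module Mates {A V : Set} (end : A → V) (mates : ∀ a → Mate end a) where

  opaque
    mate : A → A
    mate a = proj₁ (mates a)

    mate-≢ : ∀ a → mate a ≢ a
    mate-≢ a = proj₁ (proj₂ (mates a))

    mate-end : ∀ a → end (mate a) ≡ end a
    mate-end a = proj₁ (proj₂ (proj₂ (mates a)))

    mate-unique : ∀ {a b} → a ≢ b → end a ≡ end b → b ≡ mate a
    mate-unique {a} a≢b eq with proj₂ (proj₂ (proj₂ (mates a))) (sym eq)
    ... | inj₁ b≡a = contradiction (sym b≡a) a≢b
    ... | inj₂ b≡m = b≡m

  mate-involutive : ∀ a → mate (mate a) ≡ a
  mate-involutive a = sym (mate-unique (mate-≢ a) (mate-end a))

  mate-injective : Injective _≡_ _≡_ mate
  mate-injective {a} {b} eq = trans (sym (mate-involutive a)) (trans (cong mate eq) (mate-involutive b))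


module Degrees (X : Digraph) where
  open Digraph X using (_≟ᵥ_; inDegree; outDegree)

  entry-no-in : ∀ {v} → IsEntry X v → ∀ {a} → tgt X a ≢ v
  entry-no-in {v} (in0 , _) = count-0⇒none (arc-finite X) (λ a → tgt X a ≟ᵥ v) in0

  exit-no-out : ∀ {v} → IsExit X v → ∀ {a} → src X a ≢ v
  exit-no-out {v} (_ , out0) = count-0⇒none (arc-finite X) (λ a → src X a ≟ᵥ v) out0

  two-in : ∀ {v} → inDegree v ≡ 2 → Two (λ a → tgt X a ≡ v)
  two-in {v} = count-2⇒two (arc-finite X) (λ a → tgt X a ≟ᵥ v)

  two-out : ∀ {v} → outDegree v ≡ 2 → Two (λ a → src X a ≡ v)
  two-out {v} = count-2⇒two (arc-finite X) (λ a → src X a ≟ᵥ v)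

  two-in⁻ : ∀ {v} → Two (λ a → tgt X a ≡ v) → inDegree v ≡ 2
  two-in⁻ {v} = two⇒count-2 (arc-finite X) (λ a → tgt X a ≟ᵥ v)

  two-out⁻ : ∀ {v} → Two (λ a → src X a ≡ v) → outDegree v ≡ 2
  two-out⁻ {v} = two⇒count-2 (arc-finite X) (λ a → src X a ≟ᵥ v)

  no-in⁻ : ∀ {v} → (∀ {a} → tgt X a ≢ v) → inDegree v ≡ 0
  no-in⁻ {v} = none⇒count-0 (arc-finite X) (λ a → tgt X a ≟ᵥ v)

  no-out⁻ : ∀ {v} → (∀ {a} → src X a ≢ v) → outDegree v ≡ 0
  no-out⁻ {v} = none⇒count-0 (arc-finite X) (λ a → src X a ≟ᵥ v)

-- The local form of `IsFactor`, equivalent to it in a 2-digraph. It speaks of pairs of arcs instead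
-- of whole alternating cycles, and therefore passes easily to the sides of a gluing and back.
Alternates : (X : Digraph) → (Arc X → Bool) → Set
Alternates X Φ = (∀ {a b} → a ≢ b → tgt X a ≡ tgt X b → Φ a ≡ not (Φ b))
               × (∀ {a b} → a ≢ b → src X a ≡ src X b → Φ a ≡ not (Φ b))

alternates⇒IsFactor : ∀ {X Φ} → Alternates X Φ → IsFactor X Φ
alternates⇒IsFactor {X} {Φ} (alt-tgt , alt-src) c = by-value (Φ (fwd zero)) refl
  where
  open AlternatingCycle c
  fwd-bwd : ∀ i j → fwd i ≢ bwd j
  fwd-bwd i j eq with () ← distinct {inj₁ i} {inj₂ j} eq

  bwd-value : ∀ i → Φ (bwd i) ≡ not (Φ (fwd i))
  bwd-value i = alt-tgt (fwd-bwd i i ∘ sym) (sym (common-end i))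

  fwd-constant : ∀ i → Φ (fwd i) ≡ Φ (fwd zero)
  fwd-constant = next-constant (Φ ∘ fwd) λ i → not-injective
    (trans (sym (alt-src (fwd-bwd (next i) i ∘ sym) (common-start i))) (bwd-value i))

  bwd-constant : ∀ i → Φ (bwd i) ≡ not (Φ (fwd zero))
  bwd-constant i = trans (bwd-value i) (cong not (fwd-constant i))

  by-value : ∀ b → Φ (fwd zero) ≡ b →
    (∀ i → Φ (fwd i) ≡ true  × Φ (bwd i) ≡ false) ⊎
    (∀ i → Φ (fwd i) ≡ false × Φ (bwd i) ≡ true)
  by-value true  eq = inj₁ λ i → trans (fwd-constant i) eq , trans (bwd-constant i) (cong not eq)
  by-value false eq = inj₂ λ i → trans (fwd-constant i) eq , trans (bwd-constant i) (cong not eq)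

module TwoDigraph (X : Digraph) (X-2 : Is2Digraph X) where
  open Degrees X

  two-in-at : ∀ a → Two (λ b → tgt X b ≡ tgt X a)
  two-in-at a with X-2 (tgt X a)
  ... | inj₁ entry             = contradiction refl (entry-no-in entry)
  ... | inj₂ (inj₁ (in2 , _))  = two-in in2
  ... | inj₂ (inj₂ (in2 , _))  = two-in in2

  two-out-at : ∀ a → Two (λ b → src X b ≡ src X a)
  two-out-at a with X-2 (src X a)
  ... | inj₁ (_ , out2)        = two-out out2
  ... | inj₂ (inj₁ exit)       = contradiction refl (exit-no-out exit)
  ... | inj₂ (inj₂ (_ , out2)) = two-out out2

  open Mates (tgt X) (λ a → two⇒mate (tgt X) (two-in-at a)) renaming
    ( mate to t; mate-≢ to t-≢; mate-end to tgt-t; mate-unique to t-unique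
    ; mate-involutive to t-involutive; mate-injective to t-injective )
  open Mates (src X) (λ a → two⇒mate (src X) (two-out-at a)) renaming
    ( mate to s; mate-≢ to s-≢; mate-end to src-s; mate-unique to s-unique
    ; mate-involutive to s-involutive; mate-injective to s-injective )

  private
    -- Two steps along an alternating cycle: across the common end to the backward arc, then across
    -- the common start to the next forward arc.
    φ : Arc X → Arc X
    φ = s ∘ t

    φ-injective : Injective _≡_ _≡_ φ
    φ-injective = t-injective ∘ s-injective

    module _ (a : Arc X) where
      at : ℕ → Arc X
      at = fold a φ

      shift : ∀ {i j} → at i ≡ t (at (suc j)) → at (suc i) ≡ t (at j)
      shift {i} {j} eq = begin
        s (t (at i))                 ≡⟨ cong φ eq ⟩
        s (t (t (at (suc j))))       ≡⟨ cong s (t-involutive (at (suc j))) ⟩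
        s (s (t (at j)))             ≡⟨ s-involutive (t (at j)) ⟩
        t (at j)                     ∎
        where open ≡-Reasoning

      -- t φ t = φ⁻¹, so a coincidence of a forward and a backward arc moves
      -- inwards until it becomes a fixed point of t or of s.
      at-≢-t-ahead : ∀ d i → at i ≢ t (at (i + d))
      at-≢-t-ahead zero i eq rewrite ℕ.+-identityʳ i = t-≢ (at i) (sym eq)
      at-≢-t-ahead (suc zero) i eq rewrite ℕ.+-comm i 1 = s-≢ (t (at i)) (shift {i} {i} eq)
      at-≢-t-ahead (suc (suc d)) i eq = at-≢-t-ahead d (suc i)
        (shift {i} {suc (i + d)} (trans eq (cong (t ∘ at) (trans (ℕ.+-suc i (suc d)) (cong suc (ℕ.+-suc i d))))))

      at-≢-t : ∀ i j → at i ≢ t (at j)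
      at-≢-t i j eq with ℕ.≤-total i j
      ... | inj₁ i≤j with d , refl ← ℕ.m≤n⇒∃[o]m+o≡n i≤j = at-≢-t-ahead d i eq
      ... | inj₂ j≤i with d , refl ← ℕ.m≤n⇒∃[o]m+o≡n j≤i =
        at-≢-t-ahead d j (trans (sym (t-involutive (at j))) (cong t (sym eq)))

      through : Orbit φ a → AlternatingCycle X
      through O = record
        { fwd          = point
        ; bwd          = t ∘ point
        ; distinct     = λ { {inj₁ i} {inj₁ j} eq → cong inj₁ (injective eq)
                           ; {inj₁ i} {inj₂ j} eq → contradiction eq (at-≢-t (toℕ i) (toℕ j))
                           ; {inj₂ i} {inj₁ j} eq → contradiction (sym eq) (at-≢-t (toℕ j) (toℕ i))
                           ; {inj₂ i} {inj₂ j} eq → cong inj₂ (injective (t-injective eq)) }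
        ; common-end   = λ i → sym (tgt-t (point i))
        ; common-start = λ i → trans (sym (src-s (t (point i)))) (cong (src X) (point-next i))
        }
        where open Orbit O

    orbit-at : ∀ a → Orbit φ a
    orbit-at = orbit (arc-finite X) φ φ-injective

  open AlternatingCycle

  AC-through-in : ∀ {a b} → a ≢ b → tgt X a ≡ tgt X b →
    Σ[ c ∈ AlternatingCycle X ] ∃[ i ] fwd c i ≡ a × bwd c i ≡ b
  AC-through-in {a} a≢b eq = through a (orbit-at a) , zero , refl , sym (t-unique a≢b eq)

  AC-through-out : ∀ {a b} → a ≢ b → src X a ≡ src X b →
    Σ[ c ∈ AlternatingCycle X ] ∃[ i ] bwd c i ≡ a × fwd c (next i) ≡ b
  -- Starting from `t a` makes a = t (t a) the first backward arc, and the forward arc after it is s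
  -- a = b.
  AC-through-out {a} {b} a≢b eq = through (t a) (orbit-at (t a)) , zero , t-involutive a ,
    trans (sym (Orbit.point-next (orbit-at (t a)) zero)) (trans (cong s (t-involutive a)) (sym (s-unique a≢b eq)))

  -- Two distinct arcs with a common end-vertex or start-vertex are neighbours on some alternating
  -- cycle, one forward and one backward, so a factor contains exactly one of them.
  IsFactor⇒alternates : ∀ {Φ} → IsFactor X Φ → Alternates X Φ
  IsFactor⇒alternates {Φ} factor = alt-tgt , alt-src
    where
    alt-tgt : ∀ {a b} → a ≢ b → tgt X a ≡ tgt X b → Φ a ≡ not (Φ b)
    alt-tgt a≢b eq with c , i , refl , refl ← AC-through-in a≢b eq with factor c
    ... | inj₁ h rewrite proj₁ (h i) | proj₂ (h i) = refl
    ... | inj₂ h rewrite proj₁ (h i) | proj₂ (h i) = refl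

    alt-src : ∀ {a b} → a ≢ b → src X a ≡ src X b → Φ a ≡ not (Φ b)
    alt-src a≢b eq with c , i , refl , refl ← AC-through-out a≢b eq with factor c
    ... | inj₁ h rewrite proj₁ (h (next i)) | proj₂ (h i) = refl
    ... | inj₂ h rewrite proj₁ (h (next i)) | proj₂ (h i) = refl

  member-in : (K : ACSet X) → ∀ {a b} → tgt X a ≡ tgt X b → ACSet.member K a ≡ ACSet.member K b
  member-in K {a} {b} eq with Finite._≟_ (arc-finite X) a b
  ... | yes refl = refl
  ... | no a≢b with c , i , refl , refl ← AC-through-in a≢b eq =
    ACSet.closed K c (inj₁ i , refl) (inj₂ i , refl)

  member-out : (K : ACSet X) → ∀ {a b} → src X a ≡ src X b → ACSet.member K a ≡ ACSet.member K b
  member-out K {a} {b} eq with Finite._≟_ (arc-finite X) a b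
  ... | yes refl = refl
  ... | no a≢b with c , i , refl , refl ← AC-through-out a≢b eq =
    ACSet.closed K c (inj₂ i , refl) (inj₁ (next i) , refl)

-- Open factors and routes

×-≡-irrelevant : {a b c d : ℕ} (p q : a ≡ b × c ≡ d) → p ≡ q
×-≡-irrelevant (p , q) (p′ , q′) = cong₂ _,_ (ℕ.≡-irrelevant p p′) (ℕ.≡-irrelevant q q′)

entry-≡ : ∀ {X} {u v : Entry X} → proj₁ u ≡ proj₁ v → u ≡ v
entry-≡ {u = u , p} {.u , q} refl = cong (u ,_) (×-≡-irrelevant p q)

exit-≡ : ∀ {X} {u v : Exit X} → proj₁ u ≡ proj₁ v → u ≡ v
exit-≡ {u = u , p} {.u , q} refl = cong (u ,_) (×-≡-irrelevant p q)

module Labels {X : Digraph} {n} (ℓ : Labelling X n) where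
  open Labelling ℓ

  entryᵥ exitᵥ : Fin n → Vertex X
  entryᵥ = proj₁ ∘ Inverse.to entry
  exitᵥ  = proj₁ ∘ Inverse.to exit

  entryᵥ-IsEntry : ∀ i → IsEntry X (entryᵥ i)
  entryᵥ-IsEntry = proj₂ ∘ Inverse.to entry

  exitᵥ-IsExit : ∀ i → IsExit X (exitᵥ i)
  exitᵥ-IsExit = proj₂ ∘ Inverse.to exit

  entryᵥ-injective : Injective _≡_ _≡_ entryᵥ
  entryᵥ-injective = ↔-injective entry ∘ entry-≡ {X}

  exitᵥ-injective : Injective _≡_ _≡_ exitᵥ
  exitᵥ-injective = ↔-injective exit ∘ exit-≡ {X}

  entryᵥ-surjective : ∀ {v} → IsEntry X v → ∃[ i ] entryᵥ i ≡ v
  entryᵥ-surjective {v} e = Inverse.from entry (v , e) , cong proj₁ (Inverse.strictlyInverseˡ entry (v , e))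

  exitᵥ-surjective : ∀ {v} → IsExit X v → ∃[ i ] exitᵥ i ≡ v
  exitᵥ-surjective {v} x = Inverse.from exit (v , x) , cong proj₁ (Inverse.strictlyInverseˡ exit (v , x))

module Alternating (X : Digraph) (Φ : Arc X → Bool) (alternates : Alternates X Φ) where

  OutArc : Vertex X → Set
  OutArc v = ∃[ a ] T (Φ a) × src X a ≡ v

  private
    one-of : ∀ {a b} → Φ a ≡ not (Φ b) → T (Φ a) ⊎ T (Φ b)
    one-of {a} {b} eq with Φ a | Φ b
    one-of eq | true  | _    = inj₁ tt
    one-of eq | false | true = inj₂ tt

    not-both : ∀ {a b} → T (Φ a) → T (Φ b) → Φ a ≢ not (Φ b)
    not-both {a} {b} ta tb eq with Φ a | Φ b
    not-both ta tb () | true | true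

  out-arc : ∀ {v} → Two (λ a → src X a ≡ v) → OutArc v
  out-arc (a , b , a≢b , refl , eq , _) with one-of (proj₂ alternates a≢b (sym eq))
  ... | inj₁ ta = a , ta , refl
  ... | inj₂ tb = b , tb , eq

  out-unique : ∀ {a b} → T (Φ a) → T (Φ b) → src X a ≡ src X b → a ≡ b
  out-unique {a} {b} ta tb eq with Finite._≟_ (arc-finite X) a b
  ... | yes a≡b = a≡b
  ... | no a≢b  = contradiction (proj₂ alternates a≢b eq) (not-both ta tb)

  in-unique : ∀ {a b} → T (Φ a) → T (Φ b) → tgt X a ≡ tgt X b → a ≡ b
  in-unique {a} {b} ta tb eq with Finite._≟_ (arc-finite X) a b
  ... | yes a≡b = a≡b
  ... | no a≢b  = contradiction (proj₁ alternates a≢b eq) (not-both ta tb)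

unsnoc : {A : Set} {R : A → A → Set} {x z : A} → Star R x z → x ≡ z ⊎ (∃[ y ] Star R x y × R y z)
unsnoc ε = inj₁ refl
unsnoc (r ◅ rs) with unsnoc rs
... | inj₁ refl             = inj₂ (_ , ε , r)
... | inj₂ (y , rs′ , last) = inj₂ (y , r ◅ rs′ , last)

module OpenFactor {X : Digraph} (X-2 : Is2Digraph X) {n} (ℓ : Labelling X n)
                  {Φ : Arc X → Bool} (open-Φ : IsOpenFactor X Φ) where
  open Labels ℓ
  open Degrees X

  alternates : Alternates X Φ
  alternates = TwoDigraph.IsFactor⇒alternates X X-2 (proj₁ open-Φ)

  open Alternating X Φ alternates

  Path : Vertex X → Vertex X → Set
  Path = Star (Step X Φ)

  out-or-exit : ∀ v → OutArc v ⊎ IsExit X v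
  out-or-exit v with X-2 v
  ... | inj₁ (_ , out2)        = inj₁ (out-arc (two-out out2))
  ... | inj₂ (inj₁ exit)       = inj₂ exit
  ... | inj₂ (inj₂ (_ , out2)) = inj₁ (out-arc (two-out out2))

  private
    -- Closing up the paths by sending the exit labelled i to the entry labelled
    -- i turns the factor into a permutation of the vertices.
    close : ∀ {v} → OutArc v ⊎ IsExit X v → Vertex X
    close (inj₁ (a , _)) = tgt X a
    close (inj₂ exit)    = entryᵥ (proj₁ (exitᵥ-surjective exit))

    close-injective : ∀ {u v} (x : OutArc u ⊎ IsExit X u) (y : OutArc v ⊎ IsExit X v) →
                      close x ≡ close y → u ≡ v
    close-injective (inj₁ (a , ta , refl)) (inj₁ (b , tb , refl)) eq = cong (src X) (in-unique ta tb eq)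
    close-injective (inj₁ (a , _)) (inj₂ exit) eq =
      contradiction eq (entry-no-in (entryᵥ-IsEntry _))
    close-injective (inj₂ exit) (inj₁ (b , _)) eq =
      contradiction (sym eq) (entry-no-in (entryᵥ-IsEntry _))
    close-injective (inj₂ x) (inj₂ y) eq = trans (sym (proj₂ (exitᵥ-surjective x)))
      (trans (cong exitᵥ (entryᵥ-injective eq)) (proj₂ (exitᵥ-surjective y)))

    advance : Vertex X → Vertex X
    advance v = close (out-or-exit v)

    advance-injective : Injective _≡_ _≡_ advance
    advance-injective {u} {v} = close-injective (out-or-exit u) (out-or-exit v)

    ReachesExit : Vertex X → Set
    ReachesExit v = ∃[ i ] Path v (exitᵥ i)

    step-or-exit : ∀ v → Step X Φ v (advance v) ⊎ IsExit X v
    step-or-exit v with out-or-exit v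
    ... | inj₁ (a , ta , eq) = inj₁ (a , ta , eq , refl)
    ... | inj₂ exit = inj₂ exit

    exit-reaches : ∀ {v} → IsExit X v → ReachesExit v
    exit-reaches exit with i , refl ← exitᵥ-surjective exit = i , ε

    reaches-back : ∀ v → ReachesExit (advance v) → ReachesExit v
    reaches-back v (i , path) with step-or-exit v
    ... | inj₁ step = i , step ◅ path
    ... | inj₂ exit = exit-reaches exit

    reaches-fold : ∀ k v → ReachesExit (fold v advance k) → ReachesExit v
    reaches-fold zero    v r = r
    reaches-fold (suc k) v r = reaches-fold k v (reaches-back _ r)

    search : ∀ {k} (p : Fin k → Vertex X) → (∀ i → OutArc (p i)) ⊎ (∃[ i ] IsExit X (p i))
    search {zero}  p = inj₁ λ ()
    search {suc k} p with out-or-exit (p zero) | search (p ∘ suc)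
    ... | inj₂ exit | _               = inj₂ (zero , exit)
    ... | inj₁ _    | inj₂ (i , exit) = inj₂ (suc i , exit)
    ... | inj₁ out  | inj₁ outs       = inj₁ λ { zero → out ; (suc i) → outs i }

  opaque
    -- The orbit of v under `advance` may meet an exit; its part before the first exit is then the
    -- path sought. Otherwise the orbit follows arcs of Φ all the way round and is a directed cycle,
    -- which an open factor does not have.
    reaches-exit : ∀ v → ∃[ i ] Path v (exitᵥ i)
    reaches-exit v with O ← orbit (vertex-finite X) advance advance-injective v
      with search (Orbit.point O)
    ... | inj₂ (i , exit) = reaches-fold (toℕ i) v (exit-reaches exit)
    ... | inj₁ outs = contradiction (cycle , λ i → proj₁ (proj₂ (outs i))) (proj₂ open-Φ)
      where
      open Orbit O
      follows : ∀ v ((a , _) : OutArc v) → tgt X a ≡ advance v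
      follows v (a , ta , eq) with out-or-exit v
      ... | inj₁ (b , tb , eq′) = cong (tgt X) (out-unique ta tb (trans eq (sym eq′)))
      ... | inj₂ exit = contradiction eq (exit-no-out exit)

      cycle : DirectedCycle X
      cycle = record
        { arc         = proj₁ ∘ outs
        ; consecutive = λ i → trans (follows (point i) (outs i)) (trans (point-next i) (sym (proj₂ (proj₂ (outs (next i))))))
        ; distinct    = λ {i} {j} eq → injective (trans (sym (proj₂ (proj₂ (outs i)))) (trans eq (proj₂ (proj₂ (outs j)))))
        }

  reached-exit-unique : ∀ {v i j} → Path v (exitᵥ i) → Path v (exitᵥ j) → i ≡ j
  reached-exit-unique p q = go p q refl refl
    where
    go : ∀ {v x y i j} → Path v x → Path v y → x ≡ exitᵥ i → y ≡ exitᵥ j → i ≡ j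
    go ε ε x≡ y≡ = exitᵥ-injective (trans (sym x≡) y≡)
    go {i = i} ε ((a , _ , eq , _) ◅ _) refl y≡ = contradiction eq (exit-no-out (exitᵥ-IsExit i))
    go {j = j} ((a , _ , eq , _) ◅ _) ε x≡ refl = contradiction eq (exit-no-out (exitᵥ-IsExit j))
    go ((a , ta , refl , refl) ◅ p) ((b , tb , eq , refl) ◅ q) x≡ y≡
      with refl ← out-unique tb ta eq = go p q x≡ y≡

  private
    -- Each vertex has at most one incoming arc in Φ, so two paths into x agree backwards from x
    -- until the shorter one is used up. As no arc enters an entry vertex, two entries with the same
    -- exit must coincide.
    comparable : ∀ {u v x} → Path u x → Path v x → Path u v ⊎ Path v u
    comparable ε q = inj₂ q
    comparable (step@(a , ta , eq , refl) ◅ p) q with comparable p q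
    ... | inj₁ wv = inj₁ (step ◅ wv)
    ... | inj₂ vw with unsnoc vw
    ...   | inj₁ refl = inj₁ (step ◅ ε)
    ...   | inj₂ (y , vy , (b , tb , refl , eq′)) with refl ← in-unique ta tb (sym eq′) | refl ← eq = inj₂ vy

    path-to-entry : ∀ {v i} → Path v (entryᵥ i) → v ≡ entryᵥ i
    path-to-entry {i = i} p with unsnoc p
    ... | inj₁ eq = eq
    ... | inj₂ (_ , _ , (_ , _ , _ , eq)) = contradiction eq (entry-no-in (entryᵥ-IsEntry i))

    exit-of : Fin n → Fin n
    exit-of = proj₁ ∘ reaches-exit ∘ entryᵥ

    exit-of-injective : Injective _≡_ _≡_ exit-of
    exit-of-injective {i} {j} eq with comparable (proj₂ (reaches-exit (entryᵥ i)))
      (subst (λ k → Path (entryᵥ j) (exitᵥ k)) (sym eq) (proj₂ (reaches-exit (entryᵥ j))))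
    ... | inj₁ p = entryᵥ-injective (path-to-entry p)
    ... | inj₂ p = sym (entryᵥ-injective (path-to-entry p))

  opaque
    route : Σ[ ρ ∈ Permutation′ n ] IsRoute ℓ Φ ρ
    route with ρ , ρ≗ ← injective⇒permutation exit-of exit-of-injective =
      ρ , λ i → subst (Path (entryᵥ i) ∘ exitᵥ) (sym (ρ≗ i)) (proj₂ (reaches-exit (entryᵥ i)))

-- Cycles of a factor of a 2-dd

is2DD⇒is2Digraph : ∀ D → Is2DD D → Is2Digraph D
is2DD⇒is2Digraph D D-2DD v = inj₂ (inj₂ (D-2DD v))

module Factor2DD {D : Digraph} (D-2DD : Is2DD D) {Φ : Arc D → Bool} (alternates : Alternates D Φ) where
  open Alternating D Φ alternates
  open Degrees D

  opaque
    out : ∀ v → OutArc v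
    out v = out-arc (two-out (proj₂ (D-2DD v)))

  outArc : Vertex D → Arc D
  outArc v = proj₁ (out v)

  outArc-Φ : ∀ v → T (Φ (outArc v))
  outArc-Φ v = proj₁ (proj₂ (out v))

  src-outArc : ∀ v → src D (outArc v) ≡ v
  src-outArc v = proj₂ (proj₂ (out v))

  outArc-src : ∀ {a} → T (Φ a) → outArc (src D a) ≡ a
  outArc-src ta = out-unique (outArc-Φ _) ta (src-outArc _)

  advance : Vertex D → Vertex D
  advance v = tgt D (outArc v)

  advance-src : ∀ {a} → T (Φ a) → advance (src D a) ≡ tgt D a
  advance-src ta = cong (tgt D) (outArc-src ta)

  advance-injective : Injective _≡_ _≡_ advance
  advance-injective eq = trans (sym (src-outArc _))
    (trans (cong (src D) (in-unique (outArc-Φ _) (outArc-Φ _) eq)) (src-outArc _))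

  step⇒Linked : ∀ {u v} → Step D Φ u v → Linked advance u v
  step⇒Linked (a , ta , refl , refl) {g} inv = trans (sym (inv _)) (cong g (advance-src ta))

  path⇒Linked : ∀ {u v} → Star (Step D Φ) u v → Linked advance u v
  path⇒Linked ε          inv = refl
  path⇒Linked (step ◅ p) inv = trans (step⇒Linked step inv) (path⇒Linked p inv)

  Cycle : Set
  Cycle = Setoid.Carrier (CyclesIn D Φ)

  open Setoid (CyclesIn D Φ) public using () renaming (_≈_ to _≈ᶜ_)

  base : Cycle → Vertex D
  base (c , _) = src D (DirectedCycle.arc c zero)

  opaque
    cycle-at : ∀ v → Σ[ c ∈ Cycle ] base c ≡ v
    cycle-at v = (cycle , λ i → outArc-Φ (point i)) , src-outArc (point zero)
      where
      O : Orbit advance v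
      O = orbit (vertex-finite D) advance advance-injective v
      open Orbit O

      cycle : DirectedCycle D
      cycle = record
        { arc         = λ i → outArc (point i)
        ; consecutive = λ i → trans (point-next i) (sym (src-outArc (point (next i))))
        ; distinct    = λ {i} {j} eq → injective (trans (sym (src-outArc (point i))) (trans eq (src-outArc (point j))))
        }

  module _ (c : Cycle) where
    open DirectedCycle (proj₁ c)

    private
      cycle-Φ : ∀ i → T (Φ (arc i))
      cycle-Φ = proj₂ c

    ∈cycle⇒Linked : ∀ {a} → a ∈arcs → Linked advance (base c) (src D a)
    ∈cycle⇒Linked (i , refl) {g} inv = sym (next-constant (g ∘ src D ∘ arc)
      (λ i → trans (cong g (trans (sym (consecutive i)) (sym (advance-src (cycle-Φ i))))) (inv _)) i)

    Linked⇒∈cycle : ∀ {a} → T (Φ a) → Linked advance (base c) (src D a) → a ∈arcs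
    Linked⇒∈cycle {a} ta linked with linked-transport onCycle? forward backward {base c} {src D a} linked (zero , refl)
      where
      onCycle? : ∀ v → Dec (∃[ i ] src D (arc i) ≡ v)
      onCycle? v = Fin.any? (λ i → Finite._≟_ (vertex-finite D) (src D (arc i)) v)

      forward : ∀ v → ∃[ i ] src D (arc i) ≡ v → ∃[ i ] src D (arc i) ≡ advance v
      forward v (i , refl) = next i , trans (sym (consecutive i)) (sym (advance-src (cycle-Φ i)))

      backward : ∀ v → ∃[ i ] src D (arc i) ≡ advance v → ∃[ i ] src D (arc i) ≡ v
      backward v (j , eq) with i , refl ← next-surjective j = i , advance-injective
        (trans (advance-src (cycle-Φ i)) (trans (consecutive i) eq))
    ... | i , eq = i , out-unique (cycle-Φ i) ta eq

  opaque
    -- Cycles are compared by their arc sets, but an arc of Φ lies on a cycle exactly when its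
    -- source is linked to the base vertex. Counting cycles thus becomes a question about linked
    -- vertices.
    Linked⇒≈ : ∀ {c d} → Linked advance (base c) (base d) → c ≈ᶜ d
    Linked⇒≈ {c} {d} linked a = mk⇔
      (λ a∈c → Linked⇒∈cycle d (∈⇒Φ c a∈c) λ inv → trans (sym (linked inv)) (∈cycle⇒Linked c a∈c inv))
      (λ a∈d → Linked⇒∈cycle c (∈⇒Φ d a∈d) λ inv → trans (linked inv) (∈cycle⇒Linked d a∈d inv))
      where
      ∈⇒Φ : ∀ ((c , _) : Cycle) {a} → DirectedCycle._∈arcs c a → T (Φ a)
      ∈⇒Φ (c , c-Φ) (i , refl) = c-Φ i

    ≈⇒Linked : ∀ {c d} → c ≈ᶜ d → Linked advance (base c) (base d)
    ≈⇒Linked {c} {d} c≈d = ∈cycle⇒Linked c (Equivalence.from (c≈d _) (zero , refl))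

  connected⇒IsHamiltonian : Vertex D → (∀ u v → Linked advance u v) → IsHamiltonian D
  connected⇒IsHamiltonian u connected = proj₁ c , covers
    where
    c : Cycle
    c = proj₁ (cycle-at u)

    covers : ∀ v → ∃[ i ] src D (DirectedCycle.arc (proj₁ c) i) ≡ v
    covers v with i , eq ← Linked⇒∈cycle c (outArc-Φ v) (connected (base c) (src D (outArc v))) =
      i , trans (cong (src D) eq) (src-outArc v)

private
  prev : ∀ {n} → Fin (suc n) → Fin (suc n)
  prev = proj₁ ∘ next-surjective

  next-prev : ∀ {n} (i : Fin (suc n)) → next (prev i) ≡ i
  next-prev = proj₂ ∘ next-surjective

  prev-injective : ∀ {n} → Injective _≡_ _≡_ (prev {n})
  prev-injective {n} {i} {j} eq = trans (sym (next-prev i)) (trans (cong next eq) (next-prev j))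

-- The section `prev` of `next` is injective, hence surjective on a finite type, so it is a
-- two-sided inverse.
next-injective : ∀ {n} → Injective _≡_ _≡_ (next {suc n})
next-injective {n} {i} {j} eq
  with i′ , refl ← preimage (Fin-finite (suc n)) prev prev-injective i
     | j′ , refl ← preimage (Fin-finite (suc n)) prev prev-injective j
  = cong prev (trans (sym (next-prev i′)) (trans eq (next-prev j′)))

module HamiltonianFactor {D : Digraph} (D-2DD : Is2DD D) (hamiltonian : IsHamiltonian D) where
  open DirectedCycle (proj₁ hamiltonian)
  open Degrees D

  onCycle? : ∀ a → Dec (∃[ i ] arc i ≡ a)
  onCycle? a = Fin.any? (λ i → Finite._≟_ (arc-finite D) (arc i) a)

  Φ : Arc D → Bool
  Φ a = ⌊ onCycle? a ⌋

  private
    covers : ∀ v → ∃[ i ] src D (arc i) ≡ v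
    covers = proj₂ hamiltonian

    exactly-one : ∀ {a b} → T (Φ a) ⊎ T (Φ b) → ¬ (T (Φ a) × T (Φ b)) → Φ a ≡ not (Φ b)
    exactly-one {a} {b} one notboth with Φ a | Φ b
    ... | true  | false = refl
    ... | false | true  = refl
    ... | true  | true  = contradiction (_ , _) notboth
    exactly-one (inj₁ ()) notboth | false | false
    exactly-one (inj₂ ()) notboth | false | false

    pick : ∀ {A : Set} (end : Arc D → A) {v} → Two (λ a → end a ≡ v) → ∀ {a b i} → a ≢ b →
           end a ≡ v → end b ≡ v → end (arc i) ≡ v → T (Φ a) ⊎ T (Φ b)
    pick end (x , y , _ , _ , _ , only) {a} {b} {i} a≢b ea eb ei with only ea | only eb | only ei
    ... | inj₁ a≡x | inj₁ b≡x | _        = contradiction (trans a≡x (sym b≡x)) a≢b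
    ... | inj₂ a≡y | inj₂ b≡y | _        = contradiction (trans a≡y (sym b≡y)) a≢b
    ... | inj₁ a≡x | inj₂ b≡y | inj₁ i≡x = inj₁ (fromWitness (i , trans i≡x (sym a≡x)))
    ... | inj₁ a≡x | inj₂ b≡y | inj₂ i≡y = inj₂ (fromWitness (i , trans i≡y (sym b≡y)))
    ... | inj₂ a≡y | inj₁ b≡x | inj₁ i≡x = inj₂ (fromWitness (i , trans i≡x (sym b≡x)))
    ... | inj₂ a≡y | inj₁ b≡x | inj₂ i≡y = inj₁ (fromWitness (i , trans i≡y (sym a≡y)))

  alternates : Alternates D Φ
  alternates = alt-tgt , alt-src
    where
    alt-src : ∀ {a b} → a ≢ b → src D a ≡ src D b → Φ a ≡ not (Φ b)
    alt-src {a} {b} a≢b eq with i , ei ← covers (src D a) = exactly-one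
      (pick (src D) (two-out (proj₂ (D-2DD (src D a)))) {i = i} a≢b refl (sym eq) ei)
      λ (ta , tb) → case (toWitness ta) (toWitness tb)
      where
      case : (∃[ i ] arc i ≡ a) → ¬ (∃[ j ] arc j ≡ b)
      case (i , refl) (j , refl) = a≢b (cong arc (distinct eq))

    alt-tgt : ∀ {a b} → a ≢ b → tgt D a ≡ tgt D b → Φ a ≡ not (Φ b)
    -- The cycle leaves the vertex `tgt D a` by its arc j, so it enters it by the arc i that
    -- precedes j.
    alt-tgt {a} {b} a≢b eq with j , ej ← covers (tgt D a) with i , refl ← next-surjective j = exactly-one
      (pick (tgt D) (two-in (proj₁ (D-2DD (tgt D a)))) {i = i} a≢b refl (sym eq) (trans (consecutive i) ej))
      λ (ta , tb) → case (toWitness ta) (toWitness tb)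
      where
      case : (∃[ i ] arc i ≡ a) → ¬ (∃[ j ] arc j ≡ b)
      case (i , refl) (j , refl) = a≢b (cong arc (next-injective (distinct
        (trans (sym (consecutive i)) (trans eq (consecutive j))))))

  open Factor2DD {D} D-2DD alternates

  connected : ∀ u v → Linked advance u v
  connected u v inv = trans (sym (from-base u inv)) (from-base v inv)
    where
    c : Cycle
    c = proj₁ hamiltonian , λ i → fromWitness (i , refl)

    from-base : ∀ v → Linked advance (base c) v
    from-base v inv with i , refl ← covers v = ∈cycle⇒Linked c (i , refl) inv

-- Gluings of two 2-digraphs

-- D is obtained from S false and S true by identifying the exit vertices of
-- each with the equally labelled entry vertices of the other.
record Glued (D : Digraph) (S : Bool → Digraph) {n} (ℓ : ∀ b → Labelling (S b) n) : Set where
  open module Side-labels b = Labels (ℓ b) public using (entryᵥ; exitᵥ)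
  field
    quot       : ∀ b → Vertex (S b) → Vertex D
    arc        : ∀ b → Arc (S b) → Arc D
    side       : Arc D → Σ Bool (Arc ∘ S)
    arc-side   : ∀ a → let (b , x) = side a in arc b x ≡ a
    side-arc   : ∀ b x → side (arc b x) ≡ (b , x)
    src-arc    : ∀ b x → src D (arc b x) ≡ quot b (src (S b) x)
    tgt-arc    : ∀ b x → tgt D (arc b x) ≡ quot b (tgt (S b) x)
    quot-injective  : ∀ b → Injective _≡_ _≡_ (quot b)
    quot-surjective : ∀ v → ∃[ b ] ∃[ u ] quot b u ≡ v
    junction   : ∀ {b c} → b ≢ c → ∀ i → quot b (exitᵥ b i) ≡ quot c (entryᵥ c i)
    meet       : ∀ {b c} → b ≢ c → ∀ {u v} → quot b u ≡ quot c v →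
                 (∃[ i ] u ≡ exitᵥ b i × v ≡ entryᵥ c i) ⊎ (∃[ i ] u ≡ entryᵥ b i × v ≡ exitᵥ c i)

  module _ {b c} {x : Arc (S b)} {y : Arc (S c)} where

    -- Vertices of different sides are identified only as an exit with an entry. No arc ends in an
    -- entry (and none starts in an exit), so arcs with a common end-vertex never come from
    -- different sides. Equality of the sides and of the arcs is stated in one equation of pairs
    -- because the type of y depends on its side.
    same-side-tgt : tgt D (arc b x) ≡ tgt D (arc c y) →
                    Σ[ z ∈ Arc (S b) ] (c , y) ≡ (b , z) × tgt (S b) x ≡ tgt (S b) z
    same-side-tgt eq with b Bool.≟ c | trans (sym (tgt-arc b x)) (trans eq (tgt-arc c y))
    ... | yes refl | eq′ = y , refl , quot-injective b eq′
    ... | no b≢c   | eq′ with meet b≢c eq′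
    ...   | inj₁ (i , _ , ey) = contradiction ey (Degrees.entry-no-in (S c) (Labels.entryᵥ-IsEntry (ℓ c) i))
    ...   | inj₂ (i , ex , _) = contradiction ex (Degrees.entry-no-in (S b) (Labels.entryᵥ-IsEntry (ℓ b) i))

    same-side-src : src D (arc b x) ≡ src D (arc c y) →
                    Σ[ z ∈ Arc (S b) ] (c , y) ≡ (b , z) × src (S b) x ≡ src (S b) z
    same-side-src eq with b Bool.≟ c | trans (sym (src-arc b x)) (trans eq (src-arc c y))
    ... | yes refl | eq′ = y , refl , quot-injective b eq′
    ... | no b≢c   | eq′ with meet b≢c eq′
    ...   | inj₁ (i , ex , _) = contradiction ex (Degrees.exit-no-out (S b) (Labels.exitᵥ-IsExit (ℓ b) i))
    ...   | inj₂ (i , _ , ey) = contradiction ey (Degrees.exit-no-out (S c) (Labels.exitᵥ-IsExit (ℓ c) i))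

  arc-injective : ∀ b → Injective _≡_ _≡_ (arc b)
  arc-injective b {x} {y} eq with refl ← trans (sym (side-arc b x)) (trans (cong side eq) (side-arc b y)) = refl

  join : (∀ b → Arc (S b) → Bool) → Arc D → Bool
  join Φ a = let (b , x) = side a in Φ b x

  join-arc : ∀ Φ b x → join Φ (arc b x) ≡ Φ b x
  join-arc Φ b x = cong (λ (b , x) → Φ b x) (side-arc b x)

  join-alternates : ∀ {Φ} → (∀ b → Alternates (S b) (Φ b)) → Alternates D (join Φ)
  join-alternates {Φ} alternates = alt-tgt , alt-src
    where
    alt-tgt : ∀ {a a′} → a ≢ a′ → tgt D a ≡ tgt D a′ → join Φ a ≡ not (join Φ a′)
    alt-tgt {a} {a′} a≢a′ eq with side a | arc-side a | side a′ | arc-side a′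
    ... | b , x | refl | c , y | refl with same-side-tgt eq
    ...   | z , refl , eq′ = proj₁ (alternates b) (a≢a′ ∘ cong (arc b)) eq′

    alt-src : ∀ {a a′} → a ≢ a′ → src D a ≡ src D a′ → join Φ a ≡ not (join Φ a′)
    alt-src {a} {a′} a≢a′ eq with side a | arc-side a | side a′ | arc-side a′
    ... | b , x | refl | c , y | refl with same-side-src eq
    ...   | z , refl , eq′ = proj₂ (alternates b) (a≢a′ ∘ cong (arc b)) eq′

  restrict-alternates : ∀ {Φ} → Alternates D Φ → ∀ b → Alternates (S b) (Φ ∘ arc b)
  restrict-alternates (alt-tgt , alt-src) b =
      (λ x≢y eq → alt-tgt (x≢y ∘ arc-injective b) (trans (tgt-arc b _) (trans (cong (quot b) eq) (sym (tgt-arc b _)))))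
    , (λ x≢y eq → alt-src (x≢y ∘ arc-injective b) (trans (src-arc b _) (trans (cong (quot b) eq) (sym (src-arc b _)))))

false≢true : false ≢ true
false≢true ()

true≢false : true ≢ false
true≢false ()

-- Joined open factors and the product of their routes

module _ {D S n} {ℓ : ∀ b → Labelling (S b) n} (glued : Glued D S ℓ)
         (D-2DD : Is2DD D) (S-2 : ∀ b → Is2Digraph (S b)) where
  open Glued glued

  module JoinedFactor {Φ : ∀ b → Arc (S b) → Bool} (open-Φ : ∀ b → IsOpenFactor (S b) (Φ b))
                      {ρ : Bool → Permutation′ n} (routes : ∀ b → IsRoute (ℓ b) (Φ b) (ρ b)) where

    module Side b = OpenFactor {S b} (S-2 b) (ℓ b) {Φ b} (open-Φ b)

    joined-alternates : Alternates D (join Φ)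
    joined-alternates = join-alternates Side.alternates

    open Factor2DD {D} D-2DD joined-alternates

    -- The first-return map of the joined factor on the entries of side `true`: side `true` is
    -- crossed along its route, then side `false`.
    σ : Permutation′ n
    σ = ρ true ∘ₚ ρ false

    vertex : Fin n → Vertex D
    vertex i = quot true (entryᵥ true i)

    quot-path : ∀ b {u v} → Side.Path b u v → Star (Step D (join Φ)) (quot b u) (quot b v)
    quot-path b = gmap (quot b) λ (x , tx , eu , ev) →
      arc b x , subst T (sym (join-arc Φ b x)) tx ,
      trans (src-arc b x) (cong (quot b) eu) , trans (tgt-arc b x) (cong (quot b) ev)

    route-linked : ∀ {b c} → b ≢ c → ∀ i →
      Linked advance (quot b (entryᵥ b i)) (quot c (entryᵥ c (ρ b ⟨$⟩ʳ i)))
    route-linked {b} b≢c i {g} inv = trans (path⇒Linked (quot-path b (routes b i)) inv)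
                                           (cong g (junction b≢c (ρ b ⟨$⟩ʳ i)))

    vertex-linked : ∀ i → Linked advance (vertex i) (vertex (σ ⟨$⟩ʳ i))
    vertex-linked i inv = trans (route-linked true≢false i inv)
                                (route-linked false≢true (ρ true ⟨$⟩ʳ i) inv)

    -- Both parts are open, so from any vertex the factor runs into an exit of the current side,
    -- which is a junction. In particular no cycle of the joined factor avoids the junctions.
    linked-to-vertex : ∀ v → ∃[ i ] Linked advance v (vertex i)
    linked-to-vertex v = let (b , u , eq) = quot-surjective v in
      subst (λ v → ∃[ i ] Linked advance v (vertex i)) eq (from-side b u)
      where
      from-side : ∀ b u → ∃[ i ] Linked advance (quot b u) (vertex i)
      from-side false u = let (i , path) = Side.reaches-exit false u in i , λ {g} inv →
        trans (path⇒Linked (quot-path false path) inv) (cong g (junction false≢true i))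
      from-side true u = let (i , path) = Side.reaches-exit true u in ρ false ⟨$⟩ʳ i , λ {g} inv →
        trans (path⇒Linked (quot-path true path) inv)
          (trans (cong g (junction true≢false i)) (route-linked false≢true i inv))

    -- An invariant function of the labels extends to the vertices of D by
    -- following the factor up to the next label.
    module _ {g : Fin n → Bool} (g-inv : Invariant (σ ⟨$⟩ʳ_) g) where

      private
        -- Exit i of side `false` is the junction `vertex i`. Exit i of side `true` is entry i of
        -- side `false`, whose path leads on to exit `ρ false ⟨$⟩ʳ i` of that side.
        exit-value : Bool → Fin n → Bool
        exit-value false i = g i
        exit-value true  i = g (ρ false ⟨$⟩ʳ i)

        exit-value-route : ∀ {b c} → b ≢ c → ∀ i → exit-value b i ≡ exit-value c (ρ c ⟨$⟩ʳ i)
        exit-value-route {false} {true}  _   i = sym (g-inv i)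
        exit-value-route {true}  {false} _   i = refl
        exit-value-route {false} {false} b≢c i = contradiction refl b≢c
        exit-value-route {true}  {true}  b≢c i = contradiction refl b≢c

        value : ∀ b → Vertex (S b) → Bool
        value b u = exit-value b (proj₁ (Side.reaches-exit b u))

        value-path : ∀ b {u i} → Side.Path b u (exitᵥ b i) → value b u ≡ exit-value b i
        value-path b {u} path = cong (exit-value b)
          (Side.reached-exit-unique b (proj₂ (Side.reaches-exit b u)) path)

        value-junction : ∀ {b c} → b ≢ c → ∀ i → value b (exitᵥ b i) ≡ value c (entryᵥ c i)
        value-junction {b} {c} b≢c i = trans (value-path b ε)
          (trans (exit-value-route b≢c i) (sym (value-path c (routes c i))))

        value-quot : ∀ {b c u v} → quot b u ≡ quot c v → value b u ≡ value c v
        value-quot {b} {c} eq with b Bool.≟ c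
        ... | yes refl = cong (value b) (quot-injective b eq)
        ... | no b≢c with meet b≢c eq
        ...   | inj₁ (i , refl , refl) = value-junction b≢c i
        ...   | inj₂ (i , refl , refl) = sym (value-junction (b≢c ∘ sym) i)

        extension : Vertex D → Bool
        extension v = let (b , u , _) = quot-surjective v in value b u

        extension-quot : ∀ b u → extension (quot b u) ≡ value b u
        extension-quot b u = value-quot (proj₂ (proj₂ (quot-surjective (quot b u))))

        extension-arc : ∀ b x → T (Φ b x) → extension (tgt D (arc b x)) ≡ extension (src D (arc b x))
        extension-arc b x tx = begin
          extension (tgt D (arc b x))       ≡⟨ cong extension (tgt-arc b x) ⟩
          extension (quot b (tgt (S b) x))  ≡⟨ extension-quot b _ ⟩
          value b (tgt (S b) x)             ≡⟨ value-path b ((x , tx , refl , refl) ◅ path) ⟨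
          value b (src (S b) x)             ≡⟨ extension-quot b _ ⟨
          extension (quot b (src (S b) x))  ≡⟨ cong extension (src-arc b x) ⟨
          extension (src D (arc b x))       ∎
          where
          open ≡-Reasoning
          path = proj₂ (Side.reaches-exit b (tgt (S b) x))

        extension-invariant : Invariant advance extension
        extension-invariant v = trans
          (subst (λ a → extension (tgt D a) ≡ extension (src D a)) (arc-side (outArc v))
            (let (b , x) = side (outArc v) in extension-arc b x (outArc-Φ v)))
          (cong extension (src-outArc v))

        extension-vertex : ∀ i → extension (vertex i) ≡ g i
        extension-vertex i = trans (extension-quot true _)
          (trans (value-path true (routes true i)) (g-inv i))

      vertex-linked⁻ : ∀ {i j} → Linked advance (vertex i) (vertex j) → g i ≡ g j
      vertex-linked⁻ {i} {j} linked = trans (sym (extension-vertex i))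
        (trans (linked extension-invariant) (extension-vertex j))

    connected⇒route-connected : (∀ u v → Linked advance u v) → ∀ i j → Linked (σ ⟨$⟩ʳ_) i j
    connected⇒route-connected connected i j g-inv =
      vertex-linked⁻ g-inv {i} {j} (connected (vertex i) (vertex j))

    route-connected⇒connected : (∀ i j → Linked (σ ⟨$⟩ʳ_) i j) → ∀ u v → Linked advance u v
    route-connected⇒connected connected u v {g} inv =
      trans (proj₂ (linked-to-vertex u) inv)
        (trans (connected _ _ {g ∘ vertex} (λ i → sym (vertex-linked i inv)))
          (sym (proj₂ (linked-to-vertex v) inv)))

    -- A label is sent to the cycle through its junction. Every cycle meets a junction, and labels
    -- on the same cycle of the factor are not separated by any invariant of σ, because such an
    -- invariant extends to all vertices.
    cycles : ∀ {m} → HasCycleCount D (join Φ) m → Cycles σ m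
    cycles {m} count = record
      { index      = index
      ; surjective = λ c → let (i , linked) = linked-to-vertex (base (to c)) in
          i , injective {index i} {c} (Linked⇒≈ {to (index i)} {to c} λ inv → trans (index-linked i inv) (sym (linked inv)))
      ; invariant  = λ i → injective {index (σ ⟨$⟩ʳ i)} {index i} (Linked⇒≈ {to (index (σ ⟨$⟩ʳ i))} {to (index i)} λ inv →
          trans (index-linked (σ ⟨$⟩ʳ i) inv) (trans (sym (vertex-linked i inv)) (sym (index-linked i inv))))
      ; separates  = λ {i} {j} eq g-inv → vertex-linked⁻ g-inv {i} {j} λ {g} inv →
          trans (sym (index-linked i inv)) (trans (cong (g ∘ base ∘ to) eq) (index-linked j inv))
      }
      where
      open Bijection count using (to; injective; strictlySurjective)

      index : Fin n → Fin m
      index i = proj₁ (strictlySurjective (proj₁ (cycle-at (vertex i))))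

      index-linked : ∀ i → Linked advance (base (to (index i))) (vertex i)
      index-linked i {g} inv = trans
        (≈⇒Linked {to (index i)} {proj₁ (cycle-at (vertex i))}
          (proj₂ (strictlySurjective (proj₁ (cycle-at (vertex i))))) inv)
        (cong g (proj₂ (cycle-at (vertex i))))

  module TwoRoutes {p q} (p-open : IsOpenRoute (ℓ false) p) (q-open : IsOpenRoute (ℓ true) q) where

    factor : ∀ b → Arc (S b) → Bool
    factor false = proj₁ p-open
    factor true  = proj₁ q-open

    factor-open : ∀ b → IsOpenFactor (S b) (factor b)
    factor-open false = proj₁ (proj₂ p-open)
    factor-open true  = proj₁ (proj₂ q-open)

    ρ : Bool → Permutation′ n
    ρ false = p
    ρ true  = q

    ρ-route : ∀ b → IsRoute (ℓ b) (factor b) (ρ b)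
    ρ-route false = proj₂ (proj₂ p-open)
    ρ-route true  = proj₂ (proj₂ q-open)

    open JoinedFactor {factor} factor-open {ρ} ρ-route

    -- The number m of cycles of the joined factor is also that of the product of the routes, whose
    -- sign is therefore n + m with m odd. Solving for the sign of q gives the case distinction in
    -- `residueParity`.
    parity-if-odd : IsOdd D → sgn q ≡ residueParity (sgn p) n
    parity-if-odd odd = solve (sgn p) (sgn q) (parity n) (begin
      sgn q ℙ.+ sgn p         ≡⟨ sgn-∘ₚ q p ⟨
      sgn (q ∘ₚ p)            ≡⟨ sgn-cycles (q ∘ₚ p) (cycles (proj₁ (proj₂ count))) ⟩
      parity n ℙ.+ parity m   ≡⟨ cong (parity n ℙ.+_) (proj₂ (proj₂ count)) ⟩
      parity n ℙ.+ 1ℙ         ∎)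
      where
      open ≡-Reasoning
      count = odd (join factor) (alternates⇒IsFactor joined-alternates)
      m = proj₁ count

      solve : ∀ s t u → t ℙ.+ s ≡ u ℙ.+ 1ℙ → t ≡ (if ⌊ s ℙ.≟ u ⌋ then 1ℙ else 0ℙ)
      solve 0ℙ 0ℙ 1ℙ _ = refl
      solve 0ℙ 1ℙ 0ℙ _ = refl
      solve 1ℙ 0ℙ 0ℙ _ = refl
      solve 1ℙ 1ℙ 1ℙ _ = refl

    full-cycle⇒hamiltonian : Fin n → IsFullCycle (q ∘ₚ p) → IsHamiltonian D
    full-cycle⇒hamiltonian i full =
      Factor2DD.connected⇒IsHamiltonian {D} D-2DD joined-alternates (vertex i)
        (route-connected⇒connected (IsFullCycle⇒connected (q ∘ₚ p) full))

  open-route-parity : IsOdd D → ∀ {p q} → IsOpenRoute (ℓ false) p → IsOpenRoute (ℓ true) q →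
                      sgn q ≡ residueParity (sgn p) n
  open-route-parity odd {p} {q} p-open q-open = TwoRoutes.parity-if-odd {p} {q} p-open q-open odd

  open-routes⇒hamiltonian : Fin n → ∀ {p q} → IsOpenRoute (ℓ false) p → IsOpenRoute (ℓ true) q →
                            IsFullCycle (q ∘ₚ p) → IsHamiltonian D
  open-routes⇒hamiltonian i {p} {q} p-open q-open = TwoRoutes.full-cycle⇒hamiltonian {p} {q} p-open q-open i

  module HamiltonianRoutes (label : Fin n) (hamiltonian : IsHamiltonian D) where
    open HamiltonianFactor {D} D-2DD hamiltonian using (Φ; alternates; connected)
    open Factor2DD {D} D-2DD alternates

    Φ∣ : ∀ b → Arc (S b) → Bool
    Φ∣ b = Φ ∘ arc b

    -- A cycle within one side would be the whole Hamiltonian cycle, but it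
    -- misses the entry vertices of that side.
    no-cycle : ∀ b → ¬ Setoid.Carrier (CyclesIn (S b) (Φ∣ b))
    no-cycle b (c , c-Φ) = contradiction (from-cycle (Linked⇒∈cycle image (outArc-Φ v) (connected (base image) (src D (outArc v))))) λ ()
      where
      open DirectedCycle c renaming (arc to arcᶜ)

      image : Cycle
      image = record
        { arc         = arc b ∘ arcᶜ
        ; consecutive = λ i → trans (tgt-arc b (arcᶜ i)) (trans (cong (quot b) (consecutive i)) (sym (src-arc b (arcᶜ (next i)))))
        ; distinct    = λ {i} {j} eq → distinct (quot-injective b
            (trans (sym (src-arc b (arcᶜ i))) (trans eq (src-arc b (arcᶜ j)))))
        } , c-Φ

      entry = Labels.entryᵥ (ℓ b) label
      v = quot b entry

      from-cycle : ¬ (∃[ i ] arc b (arcᶜ i) ≡ outArc v)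
      from-cycle (i , eq) with j , refl ← next-surjective i =
        Degrees.entry-no-in (S b) (Labels.entryᵥ-IsEntry (ℓ b) label)
          (trans (consecutive j) (quot-injective b (trans (sym (src-arc b (arcᶜ (next j))))
            (trans (cong (src D) eq) (src-outArc v)))))

    open-Φ∣ : ∀ b → IsOpenFactor (S b) (Φ∣ b)
    open-Φ∣ b = alternates⇒IsFactor (restrict-alternates alternates b) , no-cycle b

    ρ : Bool → Permutation′ n
    ρ b = proj₁ (OpenFactor.route {S b} (S-2 b) (ℓ b) {Φ∣ b} (open-Φ∣ b))

    routes : ∀ b → IsRoute (ℓ b) (Φ∣ b) (ρ b)
    routes b = proj₂ (OpenFactor.route {S b} (S-2 b) (ℓ b) {Φ∣ b} (open-Φ∣ b))

    ρ-open : ∀ b → IsOpenRoute (ℓ b) (ρ b)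
    ρ-open b = Φ∣ b , open-Φ∣ b , routes b

    open JoinedFactor {Φ∣} open-Φ∣ {ρ} routes using (joined-alternates; connected⇒route-connected)
    open Factor2DD {D} D-2DD joined-alternates using () renaming (advance to advanceʲ; advance-src to advanceʲ-src)

    -- `join Φ∣` agrees with `Φ` only pointwise, so the two factors come with separate `advance`
    -- functions; uniqueness of the outgoing arc identifies their values.
    joined-linked : ∀ {u v} → Linked advance u v → Linked advanceʲ u v
    joined-linked linked {g} inv = linked λ v →
      trans (cong g (trans (sym (advanceʲ-src (joined (outArc v) (outArc-Φ v)))) (cong advanceʲ (src-outArc v)))) (inv v)
      where
      joined : ∀ a → T (Φ a) → T (join Φ∣ a)
      joined a = subst (T ∘ Φ) (sym (arc-side a))

    ρ-full : IsFullCycle (ρ true ∘ₚ ρ false)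
    ρ-full = connected⇒IsFullCycle (ρ true ∘ₚ ρ false)
      (connected⇒route-connected λ u v → joined-linked (connected u v))

  hamiltonian⇒open-routes : Fin n → IsHamiltonian D →
    ∃[ p ] ∃[ q ] IsOpenRoute (ℓ false) p × IsOpenRoute (ℓ true) q × IsFullCycle (q ∘ₚ p)
  hamiltonian⇒open-routes i hamiltonian = ρ false , ρ true , ρ-open false , ρ-open true , ρ-full
    where open HamiltonianRoutes i hamiltonian

-- Subgraphs

T-not : ∀ {b} → ¬ T b → T (not b)
T-not {false} _  = tt
T-not {true}  ¬t = contradiction tt ¬t

not-T : ∀ {b} → T (not b) → ¬ T b
not-T {false} _ ()

two-nonempty : {A : Set} {P : A → Set} → Two P → ∃ P
two-nonempty (x , _ , _ , px , _) = x , px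

-- An abstract end map serves both `tgt` and `src`. A set of alternating cycles contains both or
-- neither of the arcs with a given end, so every in-degree and out-degree in the subgraph is 2 or
-- 0.
module EndInSubset {A V V′ : Set} (end : A → V) (two : ∀ v → Two (λ a → end a ≡ v))
  (P : A → Bool) (P-fibrewise : ∀ {a b} → end a ≡ end b → P a ≡ P b)
  (forget : V′ → V) (forget-injective : Injective _≡_ _≡_ forget)
  (end′ : Σ A (T ∘ P) → V′) (forget-end′ : ∀ x → forget (end′ x) ≡ end (proj₁ x)) where

  All None : V → Set
  All  v = ∀ a → end a ≡ v → T (P a)
  None v = ∀ a → end a ≡ v → ¬ T (P a)

  all-or-none : ∀ v → All v ⊎ None v
  all-or-none v with a , eq ← two-nonempty (two v) with T? (P a)
  ... | yes pa = inj₁ λ b eq′ → subst T (P-fibrewise (trans eq (sym eq′))) pa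
  ... | no ¬pa = inj₂ λ b eq′ → ¬pa ∘ subst T (P-fibrewise (trans eq′ (sym eq)))

  all⇒two : ∀ {u} → All (forget u) → Two (λ x → end′ x ≡ u)
  all⇒two {u} all with x , y , x≢y , ex , ey , only ← two (forget u) =
    (x , all x ex) , (y , all y ey) , x≢y ∘ cong proj₁ ,
    forget-injective (trans (forget-end′ _) ex) , forget-injective (trans (forget-end′ _) ey) ,
    λ { {z , pz} refl → [ (λ eq → inj₁ (Σ-T-≡ {P = P} eq)) , (λ eq → inj₂ (Σ-T-≡ {P = P} eq)) ]′ (only (sym (forget-end′ (z , pz)))) }

  none⇒none : ∀ {u} → None (forget u) → ∀ {x} → end′ x ≢ u
  none⇒none none {a , pa} refl = none a (sym (forget-end′ (a , pa))) pa

  two⇒all : ∀ {u} → Two (λ x → end′ x ≡ u) → All (forget u)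
  two⇒all {u} two′ with all-or-none (forget u)
  ... | inj₁ all  = all
  ... | inj₂ none with x , ex ← two-nonempty two′ = contradiction ex (none⇒none none)

  none⇒none⁻ : ∀ {u} → (∀ {x} → end′ x ≢ u) → None (forget u)
  none⇒none⁻ {u} none′ with all-or-none (forget u)
  ... | inj₂ none = none
  ... | inj₁ all with x , ex ← two-nonempty (all⇒two all) = contradiction ex none′

module Induced {G : Digraph} (G-2DD : Is2DD G) where
  open Degrees G using () renaming (two-in to two-inᴳ; two-out to two-outᴳ)
  open TwoDigraph G (is2DD⇒is2Digraph G G-2DD) using (member-in; member-out)

  vertex-≡ : ∀ (M : ACSet G) {u v : Vertex (induced G M)} → proj₁ u ≡ proj₁ v → u ≡ v
  vertex-≡ M = Σ-T-≡

  module _ (M : ACSet G) where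

    module In = EndInSubset (tgt G) (λ v → two-inᴳ (proj₁ (G-2DD v))) (member M) (member-in M)
                  proj₁ (vertex-≡ M) (tgt (induced G M)) (λ _ → refl)
    module Out = EndInSubset (src G) (λ v → two-outᴳ (proj₂ (G-2DD v))) (member M) (member-out M)
                  proj₁ (vertex-≡ M) (src (induced G M)) (λ _ → refl)
    open Degrees (induced G M)

    endpoint : ∀ (u : Vertex (induced G M)) → ∃[ a ] T (member M a) × (src G a ≡ proj₁ u ⊎ tgt G a ≡ proj₁ u)
    endpoint (v , e) = toWitness e

    induced-is2Digraph : Is2Digraph (induced G M)
    induced-is2Digraph u = classify (In.all-or-none (proj₁ u)) (Out.all-or-none (proj₁ u))
      where
      classify : In.All (proj₁ u) ⊎ In.None (proj₁ u) → Out.All (proj₁ u) ⊎ Out.None (proj₁ u) →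
                 IsEntry (induced G M) u ⊎ IsExit (induced G M) u ⊎ IsSaturated (induced G M) u
      classify (inj₁ in-all)  (inj₁ out-all)  = inj₂ (inj₂ (two-in⁻ (In.all⇒two in-all) , two-out⁻ (Out.all⇒two out-all)))
      classify (inj₁ in-all)  (inj₂ out-none) = inj₂ (inj₁ (two-in⁻ (In.all⇒two in-all) , no-out⁻ (Out.none⇒none out-none)))
      classify (inj₂ in-none) (inj₁ out-all)  = inj₁ (no-in⁻ (In.none⇒none in-none) , two-out⁻ (Out.all⇒two out-all))
      classify (inj₂ in-none) (inj₂ out-none) = let (a , ma , eq) = endpoint u in
        contradiction ma ([ out-none a , in-none a ]′ eq)

    entry-sides : ∀ u → IsEntry (induced G M) u → In.None (proj₁ u) × Out.All (proj₁ u)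
    entry-sides u e = In.none⇒none⁻ {u} (entry-no-in {u} e) , Out.two⇒all {u} (two-out {u} (proj₂ e))

    exit-sides : ∀ u → IsExit (induced G M) u → In.All (proj₁ u) × Out.None (proj₁ u)
    exit-sides u x = In.two⇒all {u} (two-in {u} (proj₁ x)) , Out.none⇒none⁻ {u} (exit-no-out {u} x)

    vertex-at-out : ∀ v → Out.All v → Σ[ u ∈ Vertex (induced G M) ] proj₁ u ≡ v
    vertex-at-out v all = let (a , eq) = two-nonempty (two-outᴳ (proj₂ (G-2DD v))) in
      src (induced G M) (a , all a eq) , eq

    vertex-at-in : ∀ v → In.All v → Σ[ u ∈ Vertex (induced G M) ] proj₁ u ≡ v
    vertex-at-in v all = let (a , eq) = two-nonempty (two-inᴳ (proj₁ (G-2DD v))) in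
      tgt (induced G M) (a , all a eq) , eq

    entry-at : ∀ v → In.None v → Out.All v → Σ[ e ∈ Entry (induced G M) ] proj₁ (proj₁ e) ≡ v
    entry-at v in-none out-all = let (u , eq) = vertex-at-out v out-all in
      (u , no-in⁻ {u} (In.none⇒none {u} (subst In.None (sym eq) in-none))
         , two-out⁻ {u} (Out.all⇒two {u} (subst Out.All (sym eq) out-all))) , eq

    exit-at : ∀ v → In.All v → Out.None v → Σ[ x ∈ Exit (induced G M) ] proj₁ (proj₁ x) ≡ v
    exit-at v in-all out-none = let (u , eq) = vertex-at-in v in-all in
      (u , two-in⁻ {u} (In.all⇒two {u} (subst In.All (sym eq) in-all))
         , no-out⁻ {u} (Out.none⇒none {u} (subst Out.None (sym eq) out-none))) , eq

    induced-entry-≡ : ∀ (e e′ : Entry (induced G M)) → proj₁ (proj₁ e) ≡ proj₁ (proj₁ e′) → e ≡ e′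
    induced-entry-≡ e e′ eq = entry-≡ {induced G M} {e} {e′} (vertex-≡ M {proj₁ e} {proj₁ e′} eq)

    induced-exit-≡ : ∀ (x x′ : Exit (induced G M)) → proj₁ (proj₁ x) ≡ proj₁ (proj₁ x′) → x ≡ x′
    induced-exit-≡ x x′ eq = exit-≡ {induced G M} {x} {x′} (vertex-≡ M {proj₁ x} {proj₁ x′} eq)

  -- A relation between two sets, rather than an equation with `∁ M`, lets the roles be exchanged:
  -- `∁ (∁ K)` agrees with `K` only pointwise.
  Complementary : ACSet G → ACSet G → Set
  Complementary M N = ∀ a → member N a ≡ not (member M a)

  module _ {M N : ACSet G} (M∁N : Complementary M N) where

    in-N : ∀ {a} → ¬ T (member M a) → T (member N a)
    in-N {a} ¬m = subst T (sym (M∁N a)) (T-not ¬m)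

    not-N : ∀ {a} → T (member M a) → ¬ T (member N a)
    not-N {a} m n = not-T (subst T (M∁N a) n) m

    opaque
      exit→entry : ∀ (x : Exit (induced G M)) → Σ[ e ∈ Entry (induced G N) ] proj₁ (proj₁ e) ≡ proj₁ (proj₁ x)
      exit→entry (u , x) = let (in-all , out-none) = exit-sides M u x in
        entry-at N (proj₁ u) (λ a eq → not-N (in-all a eq)) (λ a eq → in-N (out-none a eq))

      entry→exit : ∀ (e : Entry (induced G M)) → Σ[ x ∈ Exit (induced G N) ] proj₁ (proj₁ x) ≡ proj₁ (proj₁ e)
      entry→exit (u , e) = let (in-none , out-all) = entry-sides M u e in
        exit-at N (proj₁ u) (λ a eq → in-N (in-none a eq)) (λ a eq → not-N (out-all a eq))

  module _ {M N : ACSet G} (M∁N : Complementary M N) where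

    N∁M : Complementary N M
    N∁M a = trans (sym (Bool.not-involutive _)) (cong not (sym (M∁N a)))

    exit↔entry : Exit (induced G M) ↔ Entry (induced G N)
    exit↔entry = mk↔ₛ′ to from
      (λ e → induced-entry-≡ N (to (from e)) e
        (trans (proj₂ (exit→entry {M} {N} M∁N (from e))) (proj₂ (entry→exit {N} {M} N∁M e))))
      (λ x → induced-exit-≡ M (from (to x)) x
        (trans (proj₂ (entry→exit {N} {M} N∁M (to x))) (proj₂ (exit→entry {M} {N} M∁N x))))
      where
      to : Exit (induced G M) → Entry (induced G N)
      to x = proj₁ (exit→entry {M} {N} M∁N x)

      from : Entry (induced G N) → Exit (induced G M)
      from e = proj₁ (entry→exit {N} {M} N∁M e)

    entry↔exit : Entry (induced G M) ↔ Exit (induced G N)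
    entry↔exit = mk↔ₛ′ to from
      (λ x → induced-exit-≡ N (to (from x)) x
        (trans (proj₂ (entry→exit {M} {N} M∁N (from x))) (proj₂ (exit→entry {N} {M} N∁M x))))
      (λ e → induced-entry-≡ M (from (to e)) e
        (trans (proj₂ (exit→entry {N} {M} N∁M (to e))) (proj₂ (entry→exit {M} {N} M∁N e))))
      where
      to : Entry (induced G M) → Exit (induced G N)
      to e = proj₁ (entry→exit {M} {N} M∁N e)

      from : Exit (induced G N) → Entry (induced G M)
      from x = proj₁ (exit→entry {N} {M} N∁M x)

  module Complement (K : ACSet G) {n} (ℓ : Labelling (induced G K) n) where

    part : Bool → ACSet G
    part false = K
    part true  = ∁ K

    part-complementary : ∀ {b c} → b ≢ c → Complementary (part b) (part c)
    part-complementary {false} {true}  _   a = refl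
    part-complementary {true}  {false} _   a = sym (Bool.not-involutive _)
    part-complementary {false} {false} b≢c = contradiction refl b≢c
    part-complementary {true}  {true}  b≢c = contradiction refl b≢c

    S : Bool → Digraph
    S b = induced G (part b)

    -- The complement takes its labels from F across the junctions, so the routes of the two sides
    -- can be composed directly.
    labelling : ∀ b → Labelling (S b) n
    labelling false = ℓ
    labelling true  = record
      { entry = _↔-∘_ {B = Exit (induced G K)} {C = Entry (induced G (∁ K))} {A = Fin n}
                  (exit↔entry {K} {∁ K} λ _ → refl) (Labelling.exit ℓ)
      ; exit  = _↔-∘_ {B = Entry (induced G K)} {C = Exit (induced G (∁ K))} {A = Fin n}
                  (entry↔exit {K} {∁ K} λ _ → refl) (Labelling.entry ℓ)
      }

    open module Side-labels b = Labels (labelling b) using (entryᵥ; exitᵥ)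

    private
      side : Arc G → Σ Bool (Arc ∘ S)
      side a with T? (member K a)
      ... | yes m = false , a , m
      ... | no ¬m = true , a , T-not ¬m

      arc-side : ∀ a → proj₁ (proj₂ (side a)) ≡ a
      arc-side a with T? (member K a)
      ... | yes m = refl
      ... | no ¬m = refl

      side-arc : ∀ b x → side (proj₁ x) ≡ (b , x)
      side-arc b (a , m) with T? (member K a)
      side-arc false (a , m)  | yes m′ = cong (false ,_) (Σ-T-≡ {P = member K} refl)
      side-arc true  (a , ¬m) | yes m  = contradiction m (not-T ¬m)
      side-arc false (a , m)  | no ¬m  = contradiction m ¬m
      side-arc true  (a , m)  | no ¬m  = cong (true ,_) (Σ-T-≡ {P = member (∁ K)} refl)

      junction : ∀ {b c} → b ≢ c → ∀ i → proj₁ (exitᵥ b i) ≡ proj₁ (entryᵥ c i)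
      junction {false} {true}  _   i = sym (proj₂ (exit→entry {K} {∁ K} (λ _ → refl) (Inverse.to (Labelling.exit ℓ) i)))
      junction {true}  {false} _   i = proj₂ (entry→exit {K} {∁ K} (λ _ → refl) (Inverse.to (Labelling.entry ℓ) i))
      junction {false} {false} b≢c = contradiction refl b≢c
      junction {true}  {true}  b≢c = contradiction refl b≢c

      meet : ∀ {b c} → b ≢ c → ∀ {u : Vertex (S b)} {v : Vertex (S c)} → proj₁ u ≡ proj₁ v →
             (∃[ i ] u ≡ exitᵥ b i × v ≡ entryᵥ c i) ⊎ (∃[ i ] u ≡ entryᵥ b i × v ≡ exitᵥ c i)
      meet {b} {c} b≢c {u} {v} eq = classify (induced-is2Digraph (part b) u)
        where
        classify : IsEntry (S b) u ⊎ IsExit (S b) u ⊎ IsSaturated (S b) u →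
                   (∃[ i ] u ≡ exitᵥ b i × v ≡ entryᵥ c i) ⊎ (∃[ i ] u ≡ entryᵥ b i × v ≡ exitᵥ c i)
        classify (inj₁ e) = let (i , ei) = Labels.entryᵥ-surjective (labelling b) {u} e in
          inj₂ (i , sym ei , vertex-≡ (part c) {v} {exitᵥ c i}
            (trans (sym eq) (trans (cong proj₁ (sym ei)) (sym (junction (b≢c ∘ sym) i)))))
        classify (inj₂ (inj₁ x)) = let (i , ei) = Labels.exitᵥ-surjective (labelling b) {u} x in
          inj₁ (i , sym ei , vertex-≡ (part c) {v} {entryᵥ c i}
            (trans (sym eq) (trans (cong proj₁ (sym ei)) (junction b≢c i))))
        -- A vertex saturated in part b has all its arcs there, yet v is an endpoint of an arc of
        -- the complementary part c.
        classify (inj₂ (inj₂ (in2 , out2))) = let (a , ma , ea) = endpoint (part c) v in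
          contradiction ma (not-N {part b} {part c} (part-complementary b≢c)
            ([ (λ e → Out.two⇒all (part b) {u} (Degrees.two-out (S b) {u} out2) a (trans e (sym eq)))
             , (λ e → In.two⇒all (part b) {u} (Degrees.two-in (S b) {u} in2) a (trans e (sym eq))) ]′ ea))

    glued : Glued G S labelling
    glued = record
      { quot            = λ b → proj₁
      ; arc             = λ b → proj₁
      ; side            = side
      ; arc-side        = arc-side
      ; side-arc        = side-arc
      ; src-arc         = λ b x → refl
      ; tgt-arc         = λ b x → refl
      ; quot-injective  = λ b → vertex-≡ (part b)
      ; quot-surjective = λ v → let (a , ea) = two-nonempty (two-outᴳ (proj₂ (G-2DD v))) ; (b , x) = side a in
          b , src (S b) x , trans (cong (src G) (arc-side a)) ea
      ; junction        = junction
      ; meet            = meet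
      }

induced-AllACsHave6Arcs : ∀ {G} (M : ACSet G) → AllACsHave6Arcs G → AllACsHave6Arcs (induced G M)
induced-AllACsHave6Arcs {G} M six c = six record
  { fwd          = proj₁ ∘ fwd
  ; bwd          = proj₁ ∘ bwd
  ; distinct     = λ { {inj₁ i} {inj₁ j} eq → distinct {inj₁ i} {inj₁ j} (Σ-T-≡ {P = member M} eq)
                     ; {inj₁ i} {inj₂ j} eq → distinct {inj₁ i} {inj₂ j} (Σ-T-≡ {P = member M} eq)
                     ; {inj₂ i} {inj₁ j} eq → distinct {inj₂ i} {inj₁ j} (Σ-T-≡ {P = member M} eq)
                     ; {inj₂ i} {inj₂ j} eq → distinct {inj₂ i} {inj₂ j} (Σ-T-≡ {P = member M} eq) }
  ; common-end   = cong proj₁ ∘ common-end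
  ; common-start = cong proj₁ ∘ common-start
  }
  where open AlternatingCycle c

-- Construction of the gluing

not-≢ : ∀ b → not b ≢ b
not-≢ false ()
not-≢ true  ()

module _ {D S n} {ℓ : ∀ b → Labelling (S b) n} (glued : Glued D S ℓ) where
  open Glued glued
  open Degrees using (two-in; two-out; two-in⁻; two-out⁻)

  private
    two-in-quot : ∀ b {u} → Two (λ x → tgt (S b) x ≡ u) → Two (λ a → tgt D a ≡ quot b u)
    two-in-quot b {u} (x , y , x≢y , refl , ey , only) =
      arc b x , arc b y , x≢y ∘ arc-injective b , tgt-arc b x , trans (tgt-arc b y) (cong (quot b) ey) , covers
      where
      covers : ∀ {a} → tgt D a ≡ quot b u → a ≡ arc b x ⊎ a ≡ arc b y
      covers {a} eq with side a | arc-side a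
      ... | c , z | refl with same-side-tgt {b} {c} {x} {z} (trans (tgt-arc b x) (sym eq))
      ...   | _ , refl , e with only (sym e)
      ...     | inj₁ refl = inj₁ refl
      ...     | inj₂ refl = inj₂ refl

    two-out-quot : ∀ b {u} → Two (λ x → src (S b) x ≡ u) → Two (λ a → src D a ≡ quot b u)
    two-out-quot b {u} (x , y , x≢y , refl , ey , only) =
      arc b x , arc b y , x≢y ∘ arc-injective b , src-arc b x , trans (src-arc b y) (cong (quot b) ey) , covers
      where
      covers : ∀ {a} → src D a ≡ quot b u → a ≡ arc b x ⊎ a ≡ arc b y
      covers {a} eq with side a | arc-side a
      ... | c , z | refl with same-side-src {b} {c} {x} {z} (trans (src-arc b x) (sym eq))
      ...   | _ , refl , e with only (sym e)
      ...     | inj₁ refl = inj₁ refl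
      ...     | inj₂ refl = inj₂ refl

    exit-two-in : ∀ b i → Two (λ x → tgt (S b) x ≡ exitᵥ b i)
    exit-two-in b i = two-in (S b) (proj₁ (Labels.exitᵥ-IsExit (ℓ b) i))

    entry-two-out : ∀ b i → Two (λ x → src (S b) x ≡ entryᵥ b i)
    entry-two-out b i = two-out (S b) (proj₂ (Labels.entryᵥ-IsEntry (ℓ b) i))

    saturated : ∀ {v} → Two (λ a → tgt D a ≡ v) → Two (λ a → src D a ≡ v) → IsSaturated D v
    saturated {v} i o = two-in⁻ D {v} i , two-out⁻ D {v} o

    junction-saturated : ∀ {b c} → b ≢ c → ∀ i → IsSaturated D (quot c (entryᵥ c i))
    junction-saturated {b} {c} b≢c i = saturated
      (subst (λ v → Two (λ a → tgt D a ≡ v)) (junction b≢c i) (two-in-quot b (exit-two-in b i)))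
      (two-out-quot c (entry-two-out c i))

  glued-Is2DD : (∀ b → Is2Digraph (S b)) → Is2DD D
  glued-Is2DD S-2 v = let (b , u , eq) = quot-surjective v in subst (IsSaturated D) eq (classify b u (S-2 b u))
    where
    classify : ∀ b u → IsEntry (S b) u ⊎ IsExit (S b) u ⊎ IsSaturated (S b) u → IsSaturated D (quot b u)
    classify b u (inj₁ e) = let (i , eq) = Labels.entryᵥ-surjective (ℓ b) {u} e in
      subst (IsSaturated D ∘ quot b) eq (junction-saturated (not-≢ b) i)
    classify b u (inj₂ (inj₁ x)) = let (i , eq) = Labels.exitᵥ-surjective (ℓ b) {u} x in
      subst (IsSaturated D ∘ quot b) eq
        (subst (IsSaturated D) (sym (junction (not-≢ b ∘ sym) i)) (junction-saturated (not-≢ b ∘ sym) i))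
    classify b u (inj₂ (inj₂ (in2 , out2))) = saturated
      (two-in-quot b (two-in (S b) in2)) (two-out-quot b (two-out (S b) out2))

  private
    same-tgt : ∀ {b x a} → tgt D (arc b x) ≡ tgt D a → ∃[ y ] arc b y ≡ a
    same-tgt {b} {x} {a} eq with side a | arc-side a
    ... | c , z | refl with same-side-tgt {b} {c} {x} {z} eq
    ...   | _ , refl , _ = z , refl

    same-src : ∀ {b x a} → src D (arc b x) ≡ src D a → ∃[ y ] arc b y ≡ a
    same-src {b} {x} {a} eq with side a | arc-side a
    ... | c , z | refl with same-side-src {b} {c} {x} {z} eq
    ...   | _ , refl , _ = z , refl

  -- Consecutive arcs of an alternating cycle share an end and so lie on one side. Hence the whole
  -- cycle stays on the side of its first forward arc and is an alternating cycle there.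
  glued-AllACsHave6Arcs : (∀ b → AllACsHave6Arcs (S b)) → AllACsHave6Arcs D
  glued-AllACsHave6Arcs six c = six b record
    { fwd          = proj₁ ∘ fwd-in
    ; bwd          = proj₁ ∘ bwd-in
    ; distinct     = λ {i} {j} eq → distinct {i} {j} (trans (sym (in-side i)) (trans (cong (arc b) eq) (in-side j)))
    ; common-end   = λ i → quot-injective b (trans (sym (tgt-arc b _))
        (trans (cong (tgt D) (proj₂ (fwd-in i))) (trans (common-end i) (trans (cong (tgt D) (sym (proj₂ (bwd-in i)))) (tgt-arc b _)))))
    ; common-start = λ i → quot-injective b (trans (sym (src-arc b _))
        (trans (cong (src D) (proj₂ (bwd-in i))) (trans (common-start i) (trans (cong (src D) (sym (proj₂ (fwd-in (next i))))) (src-arc b _)))))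
    }
    where
    open AlternatingCycle c renaming (fwd to fwdᶜ; bwd to bwdᶜ)

    b : Bool
    b = proj₁ (side (fwdᶜ zero))

    fwd⇒bwd : ∀ i → ∃[ x ] arc b x ≡ fwdᶜ i → ∃[ x ] arc b x ≡ bwdᶜ i
    fwd⇒bwd i (x , eq) = same-tgt {b} {x} (trans (cong (tgt D) eq) (common-end i))

    fwd-in : ∀ i → ∃[ x ] arc b x ≡ fwdᶜ i
    fwd-in = next-induction (λ i → ∃[ x ] arc b x ≡ fwdᶜ i) (_ , arc-side (fwdᶜ zero)) λ i in-i →
      let (y , eq) = fwd⇒bwd i in-i in same-src {b} {y} (trans (cong (src D) eq) (common-start i))

    bwd-in : ∀ i → ∃[ x ] arc b x ≡ bwdᶜ i
    bwd-in i = fwd⇒bwd i (fwd-in i)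

    in-side : ∀ i → arc b ([ proj₁ ∘ fwd-in , proj₁ ∘ bwd-in ]′ i) ≡ [ fwdᶜ , bwdᶜ ]′ i
    in-side (inj₁ i) = proj₂ (fwd-in i)
    in-side (inj₂ i) = proj₂ (bwd-in i)

  glued-IsGluing : IsGluing (S true) (S false) D
  glued-IsGluing = record
    { H-exit↔F′-entry = α
    ; F′-exit↔H-entry = β
    ; quotient        = quotient
    ; surjective      = λ v → let (b , u , eq) = quot-surjective v in
        inject b u , λ { refl → trans (quotient-inject b u) eq }
    ; identifies      = λ x y → mk⇔ (identified x y) glued-equal
    ; arcs            = mk↔ₛ′ [ arc true , arc false ]′ split arc-split split-arc
    ; src-arcs        = λ { (inj₁ x) → src-arc true x ; (inj₂ x) → src-arc false x }
    ; tgt-arcs        = λ { (inj₁ x) → tgt-arc true x ; (inj₂ x) → tgt-arc false x }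
    }
    where
    α : Exit (S true) ↔ Entry (S false)
    α = Labelling.entry (ℓ false) ↔-∘ ↔-sym (Labelling.exit (ℓ true))

    β : Exit (S false) ↔ Entry (S true)
    β = Labelling.entry (ℓ true) ↔-∘ ↔-sym (Labelling.exit (ℓ false))

    quotient : Vertex (S true) ⊎ Vertex (S false) → Vertex D
    quotient = [ quot true , quot false ]′

    inject : ∀ b → Vertex (S b) → Vertex (S true) ⊎ Vertex (S false)
    inject true  = inj₁
    inject false = inj₂

    quotient-inject : ∀ b u → quotient (inject b u) ≡ quot b u
    quotient-inject true  u = refl
    quotient-inject false u = refl

    _~_ : (x y : Vertex (S true) ⊎ Vertex (S false)) → Set
    _~_ = EqClosure (Glue (S true) (S false) α β)

    glue-exit-entry : ∀ i → inj₁ (exitᵥ true i) ~ inj₂ (entryᵥ false i)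
    glue-exit-entry i = subst (λ j → inj₁ (exitᵥ true i) ~ inj₂ (entryᵥ false j))
      (Inverse.strictlyInverseʳ (Labelling.exit (ℓ true)) i)
      (Sym.fwd (H-exit~F′-entry (Inverse.to (Labelling.exit (ℓ true)) i)) ◅ ε)

    glue-entry-exit : ∀ i → inj₁ (entryᵥ true i) ~ inj₂ (exitᵥ false i)
    glue-entry-exit i = subst (λ j → inj₁ (entryᵥ true j) ~ inj₂ (exitᵥ false i))
      (Inverse.strictlyInverseʳ (Labelling.exit (ℓ false)) i)
      (Sym.fwd (H-entry~F′-exit (Inverse.to (Labelling.exit (ℓ false)) i)) ◅ ε)

    across : ∀ u v → quot true u ≡ quot false v → inj₁ u ~ inj₂ v
    across u v eq with meet true≢false eq
    ... | inj₁ (i , refl , refl) = glue-exit-entry i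
    ... | inj₂ (i , refl , refl) = glue-entry-exit i

    identified : ∀ x y → quotient x ≡ quotient y → x ~ y
    identified (inj₁ u) (inj₁ v) eq with refl ← quot-injective true eq = ε
    identified (inj₂ u) (inj₂ v) eq with refl ← quot-injective false eq = ε
    identified (inj₁ u) (inj₂ v) eq = across u v eq
    identified (inj₂ u) (inj₁ v) eq = Eq.symmetric _ (across v u (sym eq))

    glue-equal : ∀ {x y} → Glue (S true) (S false) α β x y → quotient x ≡ quotient y
    glue-equal (H-exit~F′-entry x) = trans
      (cong (quot true ∘ proj₁) (sym (Inverse.strictlyInverseˡ (Labelling.exit (ℓ true)) x)))
      (junction true≢false (Inverse.from (Labelling.exit (ℓ true)) x))
    glue-equal (H-entry~F′-exit x) = sym (trans
      (cong (quot false ∘ proj₁) (sym (Inverse.strictlyInverseˡ (Labelling.exit (ℓ false)) x)))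
      (junction false≢true (Inverse.from (Labelling.exit (ℓ false)) x)))

    glued-equal : ∀ {x y} → x ~ y → quotient x ≡ quotient y
    glued-equal ε           = refl
    glued-equal (Sym.fwd r ◅ p) = trans (glue-equal r) (glued-equal p)
    glued-equal (Sym.bwd r ◅ p) = trans (sym (glue-equal r)) (glued-equal p)

    to-sum : Σ Bool (Arc ∘ S) → Arc (S true) ⊎ Arc (S false)
    to-sum (true  , x) = inj₁ x
    to-sum (false , x) = inj₂ x

    split : Arc D → Arc (S true) ⊎ Arc (S false)
    split = to-sum ∘ side

    arc-to-sum : ∀ y → [ arc true , arc false ]′ (to-sum y) ≡ arc (proj₁ y) (proj₂ y)
    arc-to-sum (true  , x) = refl
    arc-to-sum (false , x) = refl

    arc-split : ∀ a → [ arc true , arc false ]′ (split a) ≡ a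
    arc-split a = trans (arc-to-sum (side a)) (arc-side a)

    split-arc : ∀ x → split ([ arc true , arc false ]′ x) ≡ x
    split-arc (inj₁ x) = cong to-sum (side-arc true x)
    split-arc (inj₂ x) = cong to-sum (side-arc false x)

Σ-Bool-finite : {A : Bool → Set} → (∀ b → Finite (A b)) → Finite (Σ Bool A)
Σ-Bool-finite {A} A-finite = record
  { size = size (A-finite true) Data.Nat.Base.+ size (A-finite false)
  ; enum = ↔-sym Fin.+↔⊎ ↔-∘ ((enum (A-finite true) ⊎-↔ enum (A-finite false)) ↔-∘ Σ↔⊎)
  }
  where
  open Finite using (size; enum)
  Σ↔⊎ : Σ Bool A ↔ (A true ⊎ A false)
  Σ↔⊎ = mk↔ₛ′ (λ { (true , x) → inj₁ x ; (false , x) → inj₂ x }) [ (true ,_) , (false ,_) ]′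
    (λ { (inj₁ x) → refl ; (inj₂ x) → refl }) (λ { (true , x) → refl ; (false , x) → refl })

-- Every vertex of the gluing is a non-exit vertex of exactly one side.
module Gluing (S : Bool → Digraph) {n} (ℓ : ∀ b → Labelling (S b) n) where

  open module Side-labels b = Labels (ℓ b) using (entryᵥ; exitᵥ)

  isExit? : ∀ b v → Dec (IsExit (S b) v)
  isExit? b v = (Digraph.inDegree (S b) v ℕ.≟ 2) ×-dec (Digraph.outDegree (S b) v ℕ.≟ 0)

  NonExit : Bool → Set
  NonExit b = Σ[ v ∈ Vertex (S b) ] False (isExit? b v)

  GluedVertex : Set
  GluedVertex = Σ Bool NonExit

  entry-point : ∀ b → Fin n → GluedVertex
  entry-point b i = b , entryᵥ b i , fromWitnessFalse (entry-not-exit i)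
    where
    entry-not-exit : ∀ i → ¬ IsExit (S b) (entryᵥ b i)
    entry-not-exit i (in2 , _) with () ← trans (sym (proj₁ (Labels.entryᵥ-IsEntry (ℓ b) i))) in2

  quot-dec : ∀ b v → Dec (IsExit (S b) v) → GluedVertex
  quot-dec b v (yes x) = entry-point (not b) (proj₁ (Labels.exitᵥ-surjective (ℓ b) x))
  quot-dec b v (no ¬x) = b , v , fromWitnessFalse ¬x

  quot : ∀ b → Vertex (S b) → GluedVertex
  quot b v = quot-dec b v (isExit? b v)

  gluing : Digraph
  gluing = record
    { Vertex        = GluedVertex
    ; Arc           = Σ Bool (Arc ∘ S)
    ; vertex-finite = Σ-Bool-finite λ b → Σ-finite (vertex-finite (S b)) (λ v → not ⌊ isExit? b v ⌋)
    ; arc-finite    = Σ-Bool-finite λ b → arc-finite (S b)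
    ; src           = λ (b , x) → quot b (src (S b) x)
    ; tgt           = λ (b , x) → quot b (tgt (S b) x)
    }

  private
    same-vertex : ∀ {b} {u v : NonExit b} → _≡_ {A = GluedVertex} (b , u) (b , v) → proj₁ u ≡ proj₁ v
    same-vertex refl = refl

    same-entry : ∀ {b c i} {u : NonExit b} → _≡_ {A = GluedVertex} (b , u) (entry-point c i) → proj₁ u ≡ entryᵥ b i
    same-entry refl = refl

    quot-exit : ∀ b i → quot b (exitᵥ b i) ≡ entry-point (not b) i
    quot-exit b i = go (isExit? b (exitᵥ b i))
      where
      go : ∀ d → quot-dec b (exitᵥ b i) d ≡ entry-point (not b) i
      go (yes x) = cong (entry-point (not b)) (Labels.exitᵥ-injective (ℓ b) (proj₂ (Labels.exitᵥ-surjective (ℓ b) x)))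
      go (no ¬x) = contradiction (Labels.exitᵥ-IsExit (ℓ b) i) ¬x

    quot-nonExit : ∀ b (u : NonExit b) → quot b (proj₁ u) ≡ (b , u)
    quot-nonExit b (v , ¬x) = go (isExit? b v)
      where
      go : ∀ d → quot-dec b v d ≡ (b , v , ¬x)
      go (yes x) = contradiction x (toWitnessFalse ¬x)
      go (no _)  = cong (b ,_) (Σ-T-≡ refl)

    quot-injective : ∀ b {u v} → quot b u ≡ quot b v → u ≡ v
    quot-injective b {u} {v} = go (isExit? b u) (isExit? b v)
      where
      go : ∀ d e → quot-dec b u d ≡ quot-dec b v e → u ≡ v
      go (yes x) (yes y) eq = trans (sym (proj₂ (Labels.exitᵥ-surjective (ℓ b) x)))
        (trans (cong (exitᵥ b) (Labels.entryᵥ-injective (ℓ (not b)) (same-vertex eq)))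
               (proj₂ (Labels.exitᵥ-surjective (ℓ b) y)))
      go (yes _) (no _)  eq = contradiction (cong proj₁ eq) (not-≢ b)
      go (no _)  (yes _) eq = contradiction (sym (cong proj₁ eq)) (not-≢ b)
      go (no _)  (no _)  eq = same-vertex eq

    junction : ∀ {b c} → b ≢ c → ∀ i → quot b (exitᵥ b i) ≡ quot c (entryᵥ c i)
    junction {b} {c} b≢c i = trans (quot-exit b i)
      (trans (cong (λ d → entry-point d i) (sym (Bool.¬-not (b≢c ∘ sym)))) (sym (quot-nonExit c _)))

    meet : ∀ {b c} → b ≢ c → ∀ {u v} → quot b u ≡ quot c v →
           (∃[ i ] u ≡ exitᵥ b i × v ≡ entryᵥ c i) ⊎ (∃[ i ] u ≡ entryᵥ b i × v ≡ exitᵥ c i)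
    meet {b} {c} b≢c {u} {v} = go (isExit? b u) (isExit? c v)
      where
      go : ∀ d e → quot-dec b u d ≡ quot-dec c v e →
           (∃[ i ] u ≡ exitᵥ b i × v ≡ entryᵥ c i) ⊎ (∃[ i ] u ≡ entryᵥ b i × v ≡ exitᵥ c i)
      go (yes x) (yes y) eq = contradiction (Bool.not-injective (cong proj₁ eq)) b≢c
      go (yes x) (no _)  eq = let (i , ei) = Labels.exitᵥ-surjective (ℓ b) x in
        inj₁ (i , sym ei , same-entry (sym eq))
      go (no _)  (yes y) eq = let (i , ei) = Labels.exitᵥ-surjective (ℓ c) y in
        inj₂ (i , same-entry eq , sym ei)
      go (no _)  (no _)  eq = contradiction (cong proj₁ eq) b≢c

  glued : Glued gluing S ℓ
  glued = record
    { quot            = quot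
    ; arc             = _,_
    ; side            = id
    ; arc-side        = λ _ → refl
    ; side-arc        = λ _ _ → refl
    ; src-arc         = λ _ _ → refl
    ; tgt-arc         = λ _ _ → refl
    ; quot-injective  = quot-injective
    ; quot-surjective = λ (b , u) → b , proj₁ u , quot-nonExit b u
    ; junction        = junction
    ; meet            = meet
    }

-- Deciding Hamiltonicity

module _ {A : Set} (A-finite : Finite A) where
  open Finite A-finite

  finite-all? : {P : A → Set} → (∀ x → Dec (P x)) → Dec (∀ x → P x)
  finite-all? {P} P? = map′
    (λ all x → subst P (Inverse.strictlyInverseʳ enum x) (all (Inverse.to enum x)))
    (λ all i → all (Inverse.from enum i))
    (Fin.all? (P? ∘ Inverse.from enum))

  -- A function rebuilt from its head and tail is only pointwise equal to the original, which is why
  -- P has to respect pointwise equality.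
  any-function? : ∀ {k} {P : (Fin k → A) → Set} → (∀ {f g} → (∀ i → f i ≡ g i) → P f → P g) →
                  (∀ f → Dec (P f)) → Dec (∃ P)
  any-function? {zero}  resp P? = map′ (λ p → _ , p) (λ (f , pf) → resp (λ ()) pf) (P? λ ())
  any-function? {suc k} {P} resp P? = map′
    (λ (x , f , p) → x Vector.∷ f , p)
    (λ (f , pf) → Vector.head f , Vector.tail f , resp (λ { zero → refl ; (suc i) → refl }) pf)
    (any? λ x → any-function? {k} {λ f → P (x Vector.∷ f)}
      (λ f≗g → resp λ { zero → refl ; (suc i) → f≗g i }) (λ f → P? (x Vector.∷ f)))

module _ (G : Digraph) where
  open Digraph G using (_≟ᵥ_)

  IsHamiltonianCycle : ∀ {l} → (Fin (suc l) → Arc G) → Set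
  IsHamiltonianCycle arc = (∀ i → tgt G (arc i) ≡ src G (arc (next i)))
                         × (∀ i j → src G (arc i) ≡ src G (arc j) → i ≡ j)
                         × (∀ v → ∃[ i ] src G (arc i) ≡ v)

  isHamiltonianCycle? : ∀ {l} (arc : Fin (suc l) → Arc G) → Dec (IsHamiltonianCycle arc)
  isHamiltonianCycle? arc =
    Fin.all? (λ i → tgt G (arc i) ≟ᵥ src G (arc (next i))) ×-dec
    Fin.all? (λ i → Fin.all? λ j → (src G (arc i) ≟ᵥ src G (arc j)) →-dec (i Fin.≟ j)) ×-dec
    finite-all? (vertex-finite G) (λ v → Fin.any? λ i → src G (arc i) ≟ᵥ v)

  isHamiltonianCycle-resp : ∀ {l} {f g : Fin (suc l) → Arc G} → (∀ i → f i ≡ g i) →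
                            IsHamiltonianCycle f → IsHamiltonianCycle g
  isHamiltonianCycle-resp f≗g (consecutive , distinct , covers) =
    (λ i → trans (cong (tgt G) (sym (f≗g i))) (trans (consecutive i) (cong (src G) (f≗g (next i))))) ,
    (λ i j eq → distinct i j (trans (cong (src G) (f≗g i)) (trans eq (cong (src G) (sym (f≗g j)))))) ,
    (λ v → let (i , eq) = covers v in i , trans (cong (src G) (sym (f≗g i))) eq)

  isHamiltonian? : Dec (IsHamiltonian G)
  isHamiltonian? = map′
    (λ (l , _ , arc , consecutive , distinct , covers) →
      record { arc = arc ; consecutive = consecutive ; distinct = λ {i} {j} → distinct i j } , covers)
    (λ (c , covers) → let open DirectedCycle c in
      -- The sources are distinct, so `suc length-1` is at most the number of vertices; this is the
      -- strict bound on `length-1` for the bounded search.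
      length-1 , Fin.injective⇒≤ (λ eq → distinct (↔-injective (Finite.enum (vertex-finite G)) eq)) ,
      arc , consecutive , (λ i j → distinct) , covers)
    (ℕ.anyUpTo? (λ l → any-function? (arc-finite G) {suc l} {IsHamiltonianCycle}
      isHamiltonianCycle-resp isHamiltonianCycle?) (Finite.size (vertex-finite G)))

-- Replacement

module _ {n} {P : Permutation′ n → Set} where

  full-cycle⇒E : ∀ {p q} → P p → IsFullCycle (q ∘ₚ p) → E P q
  full-cycle⇒E {p} {q} Pp full = p , q ∘ₚ p , Pp , full , λ i → sym (inverseˡ p)

  E⇒full-cycle : ∀ {q} → E P q → ∃[ p ] P p × IsFullCycle (q ∘ₚ p)
  E⇒full-cycle {q} (p , c , Pp , (d , eq) , q≈) = p , Pp , d , λ i → trans (q∘p≈c (d ⟨$⟩ʳ i)) (eq i)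
    where
    q∘p≈c : (q ∘ₚ p) ≈ c
    q∘p≈c i = trans (cong (p ⟨$⟩ʳ_) (q≈ i)) (inverseʳ p)

  E-resp : ∀ {σ τ} → σ ≈ τ → E P σ → E P τ
  E-resp σ≈τ (p , c , Pp , full , σ≈) = p , c , Pp , full , λ i → trans (sym (σ≈τ i)) (σ≈ i)

relabel : ∀ {X n} → Labelling X n → (v u : Permutation′ n) → Labelling X n
relabel ℓ v u = record { entry = Labelling.entry ℓ ↔-∘ v ; exit = Labelling.exit ℓ ↔-∘ u }

module _ {X n} (ℓ : Labelling X n) (v u : Permutation′ n) where

  -- In the new labels the route q reads u⁻¹qv; the hypothesis expresses this without inverses.
  relabel-open-route : ∀ {q r} → (∀ i → u ⟨$⟩ʳ (r ⟨$⟩ʳ i) ≡ q ⟨$⟩ʳ (v ⟨$⟩ʳ i)) →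
                       IsOpenRoute ℓ q → IsOpenRoute (relabel ℓ v u) r
  relabel-open-route eq (Φ , open-Φ , route) = Φ , open-Φ , λ i →
    subst (λ j → Star (Step X Φ) (Labels.entryᵥ ℓ (v ⟨$⟩ʳ i)) (Labels.exitᵥ ℓ j))
      (sym (eq i)) (route (v ⟨$⟩ʳ i))

  unrelabel-open-route : ∀ {q r} → (∀ i → u ⟨$⟩ʳ (r ⟨$⟩ʳ i) ≡ q ⟨$⟩ʳ (v ⟨$⟩ʳ i)) →
                         IsOpenRoute (relabel ℓ v u) r → IsOpenRoute ℓ q
  unrelabel-open-route {q} {r} eq (Φ , open-Φ , route) = Φ , open-Φ , λ j →
    subst (λ j → Star (Step X Φ) (Labels.entryᵥ ℓ j) (Labels.exitᵥ ℓ (q ⟨$⟩ʳ j))) (inverseʳ v)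
      (subst (λ k → Star (Step X Φ) (Labels.entryᵥ ℓ (v ⟨$⟩ʳ (v ⟨$⟩ˡ j))) (Labels.exitᵥ ℓ k))
        (eq (v ⟨$⟩ˡ j)) (route (v ⟨$⟩ˡ j)))

module _ {D S n} {ℓ : ∀ b → Labelling (S b) n} (glued : Glued D S ℓ)
         (D-2DD : Is2DD D) (S-2 : ∀ b → Is2Digraph (S b)) where

  hamiltonian⇒E : Fin n → IsHamiltonian D →
                  ∃[ q ] IsOpenRoute (ℓ true) q × E (IsOpenRoute (ℓ false)) q
  hamiltonian⇒E i ham =
    let (p , q , open-p , open-q , full) = hamiltonian⇒open-routes glued D-2DD S-2 i ham in
    q , open-q , full-cycle⇒E {P = IsOpenRoute (ℓ false)} {p} {q} open-p full

  E⇒hamiltonian : Fin n → ∀ {q} → IsOpenRoute (ℓ true) q → E (IsOpenRoute (ℓ false)) q → IsHamiltonian D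
  E⇒hamiltonian i {q} open-q q∈E =
    let (p , open-p , full) = E⇒full-cycle {P = IsOpenRoute (ℓ false)} {q} q∈E in
    open-routes⇒hamiltonian glued D-2DD S-2 i {p} {q} open-p open-q full

open-route : ∀ {X n} → Is2Digraph X → (ℓ : Labelling X n) → IsOpen X → ∃ (IsOpenRoute ℓ)
open-route {X} X-2 ℓ (Φ , open-Φ) = let (ρ , route) = OpenFactor.route {X} X-2 ℓ {Φ} open-Φ in
  ρ , Φ , open-Φ , route

parity-cancel : ∀ (a b c d : Parity) → a ℙ.+ (b ℙ.+ d) ≡ a ℙ.+ (c ℙ.+ d) → b ≡ c
parity-cancel a b c d eq = ℙ.+-cancelʳ-≡ d b c (ℙ.+-cancelˡ-≡ a (b ℙ.+ d) (c ℙ.+ d) eq)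

sgn-conjugate : ∀ {n} (y τ x : Permutation′ n) → sgn (y ∘ₚ (τ ∘ₚ x)) ≡ sgn y ℙ.+ (sgn τ ℙ.+ sgn x)
sgn-conjugate y τ x = trans (sgn-∘ₚ y (τ ∘ₚ x)) (cong (sgn y ℙ.+_) (sgn-∘ₚ τ x))

Fin1-full-cycle : (σ : Permutation′ 1) → IsFullCycle σ
Fin1-full-cycle σ = connected⇒IsFullCycle σ λ { zero zero _ → refl }

module Replacement
  (G : Digraph) (G-2DD : Is2DD G) (G-six : AllACsHave6Arcs G) (K : ACSet G)
  (F′ : Digraph) (F′-2 : Is2Digraph F′) (F′-six : AllACsHave6Arcs F′)
  {n : ℕ} (ℓ : Labelling (induced G K) n) (ℓ′ : Labelling F′ n) where

  open Induced.Complement {G} G-2DD K ℓ public using (S; labelling) renaming (glued to G-glued)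

  S-2 : ∀ b → Is2Digraph (S b)
  S-2 b = Induced.induced-is2Digraph {G} G-2DD (Induced.Complement.part {G} G-2DD K ℓ b)

  H : Digraph
  H = induced G (∁ K)

  ℓᴴ : Labelling H n
  ℓᴴ = labelling true

  S′ : Bool → Digraph
  S′ false = F′
  S′ true  = H

  S′-2 : ∀ b → Is2Digraph (S′ b)
  S′-2 false = F′-2
  S′-2 true  = S-2 true

  S′-six : ∀ b → AllACsHave6Arcs (S′ b)
  S′-six false = F′-six
  S′-six true  = induced-AllACsHave6Arcs {G} (∁ K) G-six

  module Via (v u : Permutation′ n) where

    labelling′ : ∀ b → Labelling (S′ b) n
    labelling′ false = ℓ′
    labelling′ true  = relabel {H} ℓᴴ v u

    G′ : Digraph
    G′ = Gluing.gluing S′ labelling′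

    G′-glued : Glued G′ S′ labelling′
    G′-glued = Gluing.glued S′ labelling′

    isReplacement : IsReplacement G K F′ G′
    isReplacement = glued-IsGluing G′-glued

    G′-2DD : Is2DD G′
    G′-2DD = glued-Is2DD G′-glued S′-2

    G′-six : AllACsHave6Arcs G′
    G′-six = glued-AllACsHave6Arcs G′-glued S′-six

  module Argument (label : Fin n) (odd : IsOdd G) (F-open : IsOpen (induced G K)) (F′-open : IsOpen F′)
                  (x y : Permutation′ n) (similar : R ℓ ≐ (x · R ℓ′ · y)) where

    R⇒R′ : ∀ {q q′} → (y ∘ₚ (q′ ∘ₚ x)) ≈ q → R ℓ q → ¬ E (IsOpenRoute ℓ′) q′
    R⇒R′ {q} {q′} eq q∈R q′∈E with proj₁ similar {q} q∈R
    ... | τ , (_ , τ∉E) , q≈ = τ∉E (E-resp {P = IsOpenRoute ℓ′} {q′} {τ} q′≈τ q′∈E)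
      where
      q′≈τ : q′ ≈ τ
      q′≈τ i = ⟨$⟩ʳ-injective x (begin
        x ⟨$⟩ʳ (q′ ⟨$⟩ʳ i)                        ≡⟨ cong (λ j → x ⟨$⟩ʳ (q′ ⟨$⟩ʳ j)) (inverseʳ y) ⟨
        x ⟨$⟩ʳ (q′ ⟨$⟩ʳ (y ⟨$⟩ʳ (y ⟨$⟩ˡ i)))      ≡⟨ eq (y ⟨$⟩ˡ i) ⟩
        q ⟨$⟩ʳ (y ⟨$⟩ˡ i)                         ≡⟨ q≈ (y ⟨$⟩ˡ i) ⟩
        x ⟨$⟩ʳ (τ ⟨$⟩ʳ (y ⟨$⟩ʳ (y ⟨$⟩ˡ i)))       ≡⟨ cong (λ j → x ⟨$⟩ʳ (τ ⟨$⟩ʳ j)) (inverseʳ y) ⟩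
        x ⟨$⟩ʳ (τ ⟨$⟩ʳ i)                         ∎)
        where open ≡-Reasoning

    R′⇒R : ∀ {q q′} → q ≈ (y ∘ₚ (q′ ∘ₚ x)) → R ℓ′ q′ → R ℓ q
    R′⇒R {q} {q′} eq q′∈R = proj₂ similar {q} (q′ , q′∈R , eq)

    route-parity : ∀ {p q} → IsOpenRoute ℓ p → IsOpenRoute ℓᴴ q → sgn q ≡ residueParity (sgn p) n
    route-parity {p} {q} = open-route-parity G-glued G-2DD S-2 odd {p} {q}

    -- With these labels a route q of H reads x⁻¹qy⁻¹, and R_F = x R_F′ y says that q lies in R_F
    -- exactly when x⁻¹qy⁻¹ lies in R_F′.
    module V = Via (flip y) x

    -- A Hamiltonian cycle of the gluing would give a route q′ in E_P′. The route q = xq′y of H has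
    -- the parity of R_F by oddness and avoids E_P because `G` is not Hamiltonian; so it lies in
    -- R_F, which forces q′ out of E_P′.
    nonhamiltonian-preserved : ¬ IsHamiltonian G → ¬ IsHamiltonian V.G′
    nonhamiltonian-preserved ¬ham ham′ =
      let (q′ , q′-open , q′∈E) = hamiltonian⇒E V.G′-glued V.G′-2DD S′-2 label ham′
          q = y ∘ₚ (q′ ∘ₚ x)
          q-open = unrelabel-open-route {H} ℓᴴ (flip y) x {q} {q′} (λ i → cong (λ j → x ⟨$⟩ʳ (q′ ⟨$⟩ʳ j)) (sym (inverseʳ y))) q′-open
          (p , p-open) = open-route (S-2 false) ℓ F-open
          q∈R = (p , p-open , route-parity {p} {q} p-open q-open)
              , λ q∈E → ¬ham (E⇒hamiltonian G-glued G-2DD S-2 label {q} q-open q∈E)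
      in R⇒R′ {q} {q′} (λ _ → refl) q∈R q′∈E

    untwisted : Permutation′ n → Permutation′ n
    untwisted q = flip y ∘ₚ (q ∘ₚ flip x)

    untwisted-open : ∀ q → IsOpenRoute ℓᴴ q → IsOpenRoute (V.labelling′ true) (untwisted q)
    untwisted-open q = relabel-open-route {H} ℓᴴ (flip y) x {q} {untwisted q} (λ i → inverseʳ x)

    -- This settles n = 1, where no odd permutation exists to twist by but every permutation is a
    -- full cycle.
    hamiltonian-if-all-full : (∀ σ → IsFullCycle σ) → IsHamiltonian G → IsHamiltonian V.G′
    hamiltonian-if-all-full all-full ham =
      let (q , q-open , _) = hamiltonian⇒E G-glued G-2DD S-2 label ham
          (p′ , p′-open) = open-route F′-2 ℓ′ F′-open
      in open-routes⇒hamiltonian V.G′-glued V.G′-2DD S′-2 label {p′} {untwisted q}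
           p′-open (untwisted-open q q-open) (all-full (untwisted q ∘ₚ p′))

    -- If the residues are empty they do not determine the parity of x and y;
    -- an odd twist t then corrects the parity of the routes of H.
    module _ (t : Permutation′ n) (t-odd : sgn t ≡ 1ℙ) where

      -- The exits of H are now relabelled by xt⁻¹, so that q reads tx⁻¹qy⁻¹, of the opposite sign.
      module W = Via (flip y) (flip t ∘ₚ x)

      -- Suppose that both gluings fail, so that neither q₁ = x⁻¹qy⁻¹ nor q₂ = tq₁ lies in E_P′. If
      -- q₁ had the parity of R_F′, it would lie in R_F′ and q in R_F, against q in E_P. Hence q₂
      -- has that parity and lies in R_F′, and s = xq₂y lies in R_F. Then s has the parity of q =
      -- xq₁y, so q₁ and q₂ have equal signs, although t is odd. Emptiness of the residues never has
      -- to be decided.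
      hamiltonian-preserved : IsHamiltonian G → ¬ IsHamiltonian V.G′ → ¬ ¬ IsHamiltonian W.G′
      hamiltonian-preserved ham ¬ham₁ ¬ham₂ =
        let (q , q-open , q∈E) = hamiltonian⇒E G-glued G-2DD S-2 label ham
            (p′ , p′-open) = open-route F′-2 ℓ′ F′-open
        in contra q q-open q∈E p′ p′-open
        where
        module _ (q : Permutation′ n) (q-open : IsOpenRoute ℓᴴ q) (q∈E : E (IsOpenRoute ℓ) q)
                 (p′ : Permutation′ n) (p′-open : IsOpenRoute ℓ′ p′) where
          q₁ q₂ : Permutation′ n
          q₁ = untwisted q
          q₂ = q₁ ∘ₚ t

          q≈ : q ≈ (y ∘ₚ (q₁ ∘ₚ x))
          q≈ i = sym (trans (inverseʳ x) (cong (q ⟨$⟩ʳ_) (inverseˡ y)))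

          q₁∉E : ¬ E (IsOpenRoute ℓ′) q₁
          q₁∉E = ¬ham₁ ∘ E⇒hamiltonian V.G′-glued V.G′-2DD S′-2 label {q₁}
            (untwisted-open q q-open)

          q₂∉E : ¬ E (IsOpenRoute ℓ′) q₂
          q₂∉E = ¬ham₂ ∘ E⇒hamiltonian W.G′-glued W.G′-2DD S′-2 label {q₂}
            (relabel-open-route {H} ℓᴴ (flip y) (flip t ∘ₚ x) {q} {q₂}
              (λ i → trans (cong (x ⟨$⟩ʳ_) (inverseˡ t)) (inverseʳ x)) q-open)

          r : Parity
          r = residueParity (sgn p′) n

          q₁-parity : sgn q₁ ≢ r
          q₁-parity eq = proj₂ (R′⇒R {q} {q₁} q≈ ((p′ , p′-open , eq) , q₁∉E)) q∈E

          sgn-q₂ : sgn q₂ ≡ sgn q₁ ℙ.+ 1ℙ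
          sgn-q₂ = trans (sgn-∘ₚ q₁ t) (cong (sgn q₁ ℙ.+_) t-odd)

          flipped : ∀ {a b} → a ≢ b → a ℙ.+ 1ℙ ≡ b
          flipped {0ℙ} {0ℙ} a≢b = contradiction refl a≢b
          flipped {0ℙ} {1ℙ} _   = refl
          flipped {1ℙ} {0ℙ} _   = refl
          flipped {1ℙ} {1ℙ} a≢b = contradiction refl a≢b

          s : Permutation′ n
          s = y ∘ₚ (q₂ ∘ₚ x)

          s∈R : R ℓ s
          s∈R = R′⇒R {s} {q₂} (λ _ → refl) ((p′ , p′-open , trans sgn-q₂ (flipped q₁-parity)) , q₂∉E)

          s-parity : sgn s ≡ sgn q
          s-parity = let ((p , p-open , eq) , _) = s∈R in
            trans eq (sym (route-parity {p} {q} p-open q-open))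

          same-parity : sgn q₂ ≡ sgn q₁
          same-parity = parity-cancel (sgn y) (sgn q₂) (sgn q₁) (sgn x) (begin
            sgn y ℙ.+ (sgn q₂ ℙ.+ sgn x)  ≡⟨ sgn-conjugate y q₂ x ⟨
            sgn s                         ≡⟨ s-parity ⟩
            sgn q                         ≡⟨ sgn-cong {σ = q} {y ∘ₚ (q₁ ∘ₚ x)} q≈ ⟩
            sgn (y ∘ₚ (q₁ ∘ₚ x))          ≡⟨ sgn-conjugate y q₁ x ⟩
            sgn y ℙ.+ (sgn q₁ ℙ.+ sgn x)  ∎)
            where open ≡-Reasoning

          contra : ⊥
          contra = q₁-parity (trans (sym same-parity) (trans sgn-q₂ (flipped q₁-parity)))

lemma2 :
    (G : Digraph) → Is2DD G → AllACsHave6Arcs G → IsOdd G →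
    (K : ACSet G) → ACSet.IsNonEmpty K → IsProper K → IsOpen (induced G K) →
    (F′ : Digraph) → Is2Digraph F′ → AllACsHave6Arcs F′ → IsOpen F′ →
    (n : ℕ) → 1 ≤ n →
    (ℓ : Labelling (induced G K) n) (ℓ′ : Labelling F′ n) →
    Similar ℓ′ ℓ →
    ∃[ G′ ] IsReplacement G K F′ G′ × Is2DD G′ × AllACsHave6Arcs G′ × H-Equivalent G G′
lemma2 G G-2DD G-six odd K _ _ F-open F′ F′-2 F′-six F′-open (suc n) _ ℓ ℓ′ (x , y , similar) =
  choose (isHamiltonian? G) (isHamiltonian? V.G′) n refl
  where
  open Replacement G G-2DD G-six K F′ F′-2 F′-six ℓ ℓ′
  open Argument zero odd F-open F′-open x y similar

  Goal : Set₁
  Goal = ∃[ G′ ] IsReplacement G K F′ G′ × Is2DD G′ × AllACsHave6Arcs G′ × H-Equivalent G G′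

  via : ∀ v u → H-Equivalent G (Via.G′ v u) → Goal
  via v u H-equivalent = G′ , isReplacement , G′-2DD , G′-six , H-equivalent
    where open Via v u

  -- The number n is passed once more as m, so that one label and at least two labels are told apart
  -- only where the twist is required; a transposition exists in the latter case.
  choose : Dec (IsHamiltonian G) → Dec (IsHamiltonian V.G′) → ∀ m → m ≡ n → Goal
  choose (no ¬ham)  (yes ham′) _ _ = contradiction ham′ (nonhamiltonian-preserved ¬ham)
  choose (no ¬ham)  (no ¬ham′) _ _ = via (flip y) x (inj₂ (¬ham , ¬ham′))
  choose (yes ham)  (yes ham′) _ _ = via (flip y) x (inj₁ (ham , ham′))
  choose (yes ham)  (no ¬ham′) zero refl =
    contradiction (hamiltonian-if-all-full Fin1-full-cycle ham) ¬ham′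
  choose (yes ham)  (no ¬ham′) (suc m) refl = twist (isHamiltonian? (Via.G′ (flip y) (flip t ∘ₚ x)))
    where
    t : Permutation′ (suc (suc m))
    t = transpose zero (suc zero)

    twist : Dec (IsHamiltonian (Via.G′ (flip y) (flip t ∘ₚ x))) → Goal
    twist (yes ham″) = via (flip y) (flip t ∘ₚ x) (inj₁ (ham , ham″))
    twist (no ¬ham″) = contradiction ¬ham″ (hamiltonian-preserved t (sgn-transpose-01 m) ham ¬ham′)
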